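{- For a positive integer $n$, let $A(n)$ denote the number of partitions of $n$ into parts $\equiv \pm 2,\pm 3 \pmod 7$. Let $B(n)$ denote the number of bipartitions $(\pi,\lambda)$ of $n$, where $\pi$ is a partition into distinct even parts greater than $2$ with a gap of at least $4$ between consecutive parts, and $\lambda$ is a partition into distinct parts greater than $1$ such that if $e_j$ is the $j$-th part in $\pi$ (where the parts are ordered in ascending order), then the parts $e_j/2$, $e_j/2+1$ and $e_j/2+2$ are not present in $\lambda$. Let $C(n)$ denote the number of bipartitions $(\pi,\mu)$ of $n$, where $\pi$ is a partition into distinct even parts greater than $2$ with a gap of at least $4$ between consecutive parts, and $\mu$ is a partition into distinct parts greater than $1$ such that if $e_j$ is the $j$-th part in $\pi$ (where the parts are ordered in ascending order), then the parts $e_j/2+j-1$, $e_j/2+j$ and $e_j/2+j+1$ are not present in $\mu$. Then $A(n)=B(n)=C(n)$ for every positive integer $n$.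
   Context: The union $\pi\cup\lambda$ of partitions $\pi$ and $\lambda$ is the partition whose parts are those of $\pi$ and $\lambda$ together (with multiplicity), arranged in non-increasing order. A bipartition of a positive integer $n$ is an ordered pair of partitions $(\pi,\lambda)$ such that $\pi\cup\lambda$ is a partition of $n$; $\pi$ or $\lambda$ may be empty. The exclusion conditions are imposed for every part $e_j$ of $\pi$, where $e_1<e_2<\cdots$ are the parts of $\pi$. -}

module Defs where

open import Data.Fin.Base using (Fin; toℕ)
open import Data.Fin.Properties using (all?)
open import Data.List.Base
  using (List; []; _∷_; [_]; _++_; map; concatMap; cartesianProduct; deduplicate;
         filter; length; lookup; merge; reverse; upTo)
import Data.List.Properties as List
open import Data.List.Membership.Propositional using (_∈_; _∉_)
open import Data.List.Membership.Propositional.Properties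
  using (∈-map⁺; ∈-++⁺ˡ; ∈-++⁺ʳ; ∈-concat⁺′; ∈-cartesianProduct⁺; ∈-upTo⁺;
         ∈-filter⁺; ∈-filter⁻; ∈-deduplicate⁺; ∈-deduplicate⁻)
open import Data.List.Relation.Binary.Permutation.Propositional.Properties using (merge-↭)
open import Data.List.Relation.Unary.All as All using (All; []; _∷_)
open import Data.List.Relation.Unary.Any using (here)
open import Data.List.Relation.Unary.Linked using (Linked; linked?)
open import Data.List.Relation.Unary.Unique.Propositional using (Unique)
open import Data.List.Relation.Unary.Unique.DecPropositional.Properties using (deduplicate-!)
open import Data.Nat.Base
open import Data.Nat.Divisibility using (_∣_; _∣?_)
open import Data.Nat.DivMod using (_/_)
open import Data.Nat.ListAction using (sum)
open import Data.Nat.ListAction.Properties using (sum-++; sum-↭)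
open import Data.Nat.Properties
  using (_≟_; _≤?_; _<?_; _≥?_; suc-injective; m≤m+n; m+n∸m≡n)
open import Data.Product.Base using (_×_; _,_; proj₁; proj₂)
import Data.Product.Properties as Product
open import Data.Sum.Base using (_⊎_)
open import Function.Bundles using (_⇔_; mk⇔)
open import Relation.Binary.Definitions using (DecidableEquality)
open import Relation.Binary.PropositionalEquality
  using (_≡_; refl; sym; trans; cong; subst)
open import Relation.Nullary.Decidable using (Dec; _×-dec_; _⊎-dec_; ¬?)
open import Relation.Unary using (Decidable)

open import Data.List.Membership.DecPropositional _≟_ using (_∈?_)
open import Data.List.Relation.Unary.Unique.DecPropositional _≟_ using (unique?)

-- A partition is represented by the non-increasing list of its parts.
IsPartition : List ℕ → Set
IsPartition π = Linked _≥_ π × All (_> 0) π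

IsPartitionOf : ℕ → List ℕ → Set
IsPartitionOf n π = IsPartition π × sum π ≡ n

-- Merging two non-increasing lists keeps all parts, with multiplicity,
-- and the result is again non-increasing.
_∪_ : List ℕ → List ℕ → List ℕ
π ∪ μ = merge _≥?_ π μ

IsBipartitionOf : ℕ → List ℕ × List ℕ → Set
IsBipartitionOf n (π , μ) = IsPartition π × IsPartition μ × IsPartitionOf n (π ∪ μ)

-- a ≡ r or a ≡ -r (mod m)
infix 4 _≡±_mod_

_≡±_mod_ : ℕ → ℕ → ℕ → Set
a ≡± r mod m = (m ∣ ∣ a - r ∣) ⊎ (m ∣ a + r)

InA : ℕ → List ℕ → Set
InA n π = IsPartitionOf n π × All (λ p → (p ≡± 2 mod 7) ⊎ (p ≡± 3 mod 7)) π

-- Parts are listed in descending order, so a gap of at least 4 between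
-- consecutive parts x, y of the list means y + 4 ≤ x.
EvenParts : List ℕ → Set
EvenParts π = Unique π × All (λ p → 2 ∣ p × p > 2) π × Linked (λ x y → y + 4 ≤ x) π

DistinctParts : List ℕ → Set
DistinctParts μ = Unique μ × All (_> 1) μ

-- e π i is the part e_j of π in ascending order, where j = index π i
-- counts from 1.
e : (π : List ℕ) → Fin (length (reverse π)) → ℕ
e π = lookup (reverse π)

index : (π : List ℕ) → Fin (length (reverse π)) → ℕ
index π i = suc (toℕ i)

ExcludesB : List ℕ × List ℕ → Set
ExcludesB (π , μ) = ∀ i →
  (e π i / 2 ∉ μ) × (e π i / 2 + 1 ∉ μ) × (e π i / 2 + 2 ∉ μ)

ExcludesC : List ℕ × List ℕ → Set
ExcludesC (π , μ) = ∀ i → let j = index π i in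
  (e π i / 2 + j ∸ 1 ∉ μ) × (e π i / 2 + j ∉ μ) × (e π i / 2 + j + 1 ∉ μ)

InB : ℕ → List ℕ × List ℕ → Set
InB n (π , μ) =
  IsBipartitionOf n (π , μ) × EvenParts π × DistinctParts μ × ExcludesB (π , μ)

InC : ℕ → List ℕ × List ℕ → Set
InC n (π , μ) =
  IsBipartitionOf n (π , μ) × EvenParts π × DistinctParts μ × ExcludesC (π , μ)

record Enumeration {X : Set} (P : X → Set) : Set where
  field
    elements : List X
    unique   : Unique elements
    member   : ∀ {x} → x ∈ elements ⇔ P x

  size : ℕ
  size = length elements

enumerate : {X : Set} {P : X → Set} → DecidableEquality X → Decidable P →
            (xs : List X) → (∀ {x} → P x → x ∈ xs) → Enumeration P
enumerate {P = P} _≟X_ P? xs complete = record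
  { elements = deduplicate _≟X_ (filter P? xs)
  ; unique   = deduplicate-! _≟X_ (filter P? xs)
  ; member   = mk⇔
      (λ x∈ → proj₂ (∈-filter⁻ P? {xs = xs} (∈-deduplicate⁻ _≟X_ (filter P? xs) x∈)))
      (λ px → ∈-deduplicate⁺ _≟X_ (∈-filter⁺ P? (complete px) px))
  }

isPartition? : Decidable IsPartition
isPartition? π = linked? _≥?_ π ×-dec All.all? (0 <?_) π

isPartitionOf? : ∀ n → Decidable (IsPartitionOf n)
isPartitionOf? n π = isPartition? π ×-dec (sum π ≟ n)

isBipartitionOf? : ∀ n → Decidable (IsBipartitionOf n)
isBipartitionOf? n (π , μ) =
  isPartition? π ×-dec isPartition? μ ×-dec isPartitionOf? n (π ∪ μ)

≡±? : ∀ a r m → Dec (a ≡± r mod m)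
≡±? a r m = (m ∣? ∣ a - r ∣) ⊎-dec (m ∣? a + r)

inA? : ∀ n → Decidable (InA n)
inA? n π = isPartitionOf? n π ×-dec All.all? (λ p → ≡±? p 2 7 ⊎-dec ≡±? p 3 7) π

evenParts? : Decidable EvenParts
evenParts? π =
  unique? π
    ×-dec All.all? (λ p → (2 ∣? p) ×-dec (2 <? p)) π
    ×-dec linked? (λ x y → y + 4 ≤? x) π

distinctParts? : Decidable DistinctParts
distinctParts? μ = unique? μ ×-dec All.all? (1 <?_) μ

_∉?_ : ∀ x μ → Dec (x ∉ μ)
x ∉? μ = ¬? (x ∈? μ)

excludesB? : Decidable ExcludesB
excludesB? (π , μ) = all? λ i →
  ((e π i / 2) ∉? μ) ×-dec ((e π i / 2 + 1) ∉? μ) ×-dec ((e π i / 2 + 2) ∉? μ)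

excludesC? : Decidable ExcludesC
excludesC? (π , μ) = all? λ i → let j = index π i in
  ((e π i / 2 + j ∸ 1) ∉? μ) ×-dec ((e π i / 2 + j) ∉? μ) ×-dec ((e π i / 2 + j + 1) ∉? μ)

inB? : ∀ n → Decidable (InB n)
inB? n (π , μ) =
  isBipartitionOf? n (π , μ) ×-dec evenParts? π ×-dec distinctParts? μ ×-dec excludesB? (π , μ)

inC? : ∀ n → Decidable (InC n)
inC? n (π , μ) =
  isBipartitionOf? n (π , μ) ×-dec evenParts? π ×-dec distinctParts? μ ×-dec excludesC? (π , μ)

incrementHead : List ℕ → List ℕ
incrementHead []       = []
incrementHead (x ∷ xs) = suc x ∷ xs

compositions : ℕ → List (List ℕ)
compositions zero    = [ [] ]
compositions (suc n) = map (1 ∷_) (compositions n) ++ map incrementHead (compositions n)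

∈-compositions : ∀ n {xs} → All (_> 0) xs → sum xs ≡ n → xs ∈ compositions n
∈-compositions zero    {[]}              _          _  = here refl
∈-compositions zero    {suc _ ∷ _}       _          ()
∈-compositions zero    {zero ∷ _}        (() ∷ _)   _
∈-compositions (suc n) {[]}              _          ()
∈-compositions (suc n) {zero ∷ _}        (() ∷ _)   _
∈-compositions (suc n) {suc zero ∷ xs}   (_ ∷ xs>0) eq =
  ∈-++⁺ˡ (∈-map⁺ (1 ∷_) (∈-compositions n xs>0 (suc-injective eq)))
∈-compositions (suc n) {suc (suc x) ∷ _} (_ ∷ xs>0) eq =
  ∈-++⁺ʳ (map (1 ∷_) (compositions n))
    (∈-map⁺ incrementHead (∈-compositions n (z<s ∷ xs>0) (suc-injective eq)))

compositionPairs : ℕ → List (List ℕ × List ℕ)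
compositionPairs n =
  concatMap (λ k → cartesianProduct (compositions k) (compositions (n ∸ k))) (upTo (suc n))

sum-∪ : ∀ π μ → sum (π ∪ μ) ≡ sum π + sum μ
sum-∪ π μ = trans (sum-↭ (merge-↭ _≥?_ π μ)) (sum-++ π μ)

∈-compositionPairs : ∀ n {b} → IsBipartitionOf n b → b ∈ compositionPairs n
∈-compositionPairs n {π , μ} ((_ , π>0) , (_ , μ>0) , (_ , sum∪≡n)) =
  ∈-concat⁺′
    (∈-cartesianProduct⁺ (∈-compositions (sum π) π>0 refl)
                         (∈-compositions (n ∸ sum π) μ>0 sumμ))
    (∈-map⁺ (λ k → cartesianProduct (compositions k) (compositions (n ∸ k)))
            (∈-upTo⁺ (s≤s (subst (sum π ≤_) total (m≤m+n _ _)))))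
  where
  total : sum π + sum μ ≡ n
  total = trans (sym (sum-∪ π μ)) sum∪≡n

  sumμ : sum μ ≡ n ∸ sum π
  sumμ = trans (sym (m+n∸m≡n (sum π) (sum μ))) (cong (_∸ sum π) total)

_≟L_ : DecidableEquality (List ℕ)
_≟L_ = List.≡-dec _≟_

enumerationA : ∀ n → Enumeration (InA n)
enumerationA n = enumerate _≟L_ (inA? n) (compositions n)
  λ { (((_ , π>0) , sum≡n) , _) → ∈-compositions n π>0 sum≡n }

enumerationB : ∀ n → Enumeration (InB n)
enumerationB n = enumerate (Product.≡-dec _≟L_ _≟L_) (inB? n) (compositionPairs n)
  λ b → ∈-compositionPairs n (proj₁ b)

enumerationC : ∀ n → Enumeration (InC n)
enumerationC n = enumerate (Product.≡-dec _≟L_ _≟L_) (inC? n) (compositionPairs n)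
  λ c → ∈-compositionPairs n (proj₁ c)

A B C : ℕ → ℕ
A n = Enumeration.size (enumerationA n)
B n = Enumeration.size (enumerationB n)
C n = Enumeration.size (enumerationC n)

module Submission where

-- Generating functions are taken modulo q^(n+1), that is, in a commutative ring in
-- which q is nilpotent, so that all sums and products are finite.
--
-- Record a bipartition by the halves of the parts of π and by the parts of λ. Deciding
-- about the smallest admissible part first, the generating function for C satisfies
--   V(a,σ) = (1 + q^(a+σ)) V(a+1,σ) + q^(2a) V(a+2,σ+1),
-- where a bounds the halves and a+σ the other parts from below. This forces
--   V(a,σ+1) = V(a+1,σ) + q^(2a) V(a+2,σ+1),
-- and the two relations for σ = 0 are the recurrences for B, so B = C. Eliminating
-- V(a,1) shows that W(a) = V(a,0) satisfies a third-order q-difference equation, the one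
-- of the Andrews-Gordon identities for k = 3, which is solved by alternating series H.
-- This gives (q;q)_∞ W(2) = Σ_n (-1)^n q^(7n(n+1)/2-n) (1 - q^(2n+1)), and by the Jacobi
-- triple product the right-hand side is Π_i (1 - q^(7i+1)) (1 - q^(7i+6)) (1 - q^(7i+7)),
-- which is (q;q)_∞ times the generating function for A.

open import Defs using (A; B; C; enumerationB; enumerationC)
open import Algebra.Bundles using (CommutativeRing)
open import Data.Bool.Base using (Bool; true; false; not; if_then_else_)
open import Data.Empty using (⊥; ⊥-elim)
open import Data.Fin.Base using (Fin; zero; suc; toℕ)
open import Data.Integer.Base as ℤ using (ℤ; +_; -[1+_]; 0ℤ; 1ℤ)
import Data.Integer.Properties as ℤ
open import Data.List.Base using (List; []; _∷_; [_]; _++_; map; filter; length; lookup; reverse)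
open import Data.List.Membership.Propositional using (_∈_; _∉_)
open import Data.List.Membership.Propositional.Properties
  using (∈-map⁺; ∈-map⁻; ∈-++⁺ˡ; ∈-++⁺ʳ; ∈-++⁻; ∈-filter⁺; ∈-filter⁻)
open import Data.List.Membership.Propositional.Properties.WithK using (unique∧set⇒bag)
open import Data.List.Properties
  using (length-map; filter-accept; filter-reject; unfold-reverse; reverse-involutive; reverse-injective;
      map-injective)
open import Data.List.Relation.Binary.BagAndSetEquality using (∼bag⇒↭)
open import Data.List.Relation.Binary.Disjoint.Propositional using (Disjoint)
open import Data.List.Relation.Binary.Permutation.Propositional using (↭-sym)
open import Data.List.Relation.Binary.Permutation.Propositional.Properties
  using (↭-length; ↭-reverse; All-resp-↭; ∈-resp-↭; merge-↭)
open import Data.List.Relation.Unary.All as All using (All; []; _∷_)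
import Data.List.Relation.Unary.All.Properties as All
open import Data.List.Relation.Unary.AllPairs as AllPairs using (AllPairs; []; _∷_)
import Data.List.Relation.Unary.AllPairs.Properties as AllPairs
open import Data.List.Relation.Unary.Any using (here)
open import Data.List.Relation.Unary.Linked as Linked using (Linked)
open import Data.List.Relation.Unary.Linked.Properties using (AllPairs⇒Linked; Linked⇒AllPairs)
open import Data.List.Relation.Unary.Sorted.TotalOrder.Properties using (merge⁺)
open import Data.List.Relation.Unary.Unique.Propositional using (Unique)
import Data.List.Relation.Unary.Unique.Propositional.Properties as Unique
open import Data.Maybe.Base using (Maybe; just; nothing)
open import Data.Nat.Base as ℕ using (ℕ; zero; suc; _≤_; _<_; _≥_; _>_; s≤s; z≤n; NonZero)
open import Data.Nat.Divisibility using (_∣_; _∣?_; ∣-refl; ∣m∣n⇒∣m+n; ∣m+n∣m⇒∣n; n∣m*n; m∣m*n)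
open import Data.Nat.DivMod using (_/_; m*n/n≡m; m*[n/m]≡n)
open import Data.Nat.ListAction using (sum)
open import Data.Nat.ListAction.Properties using (sum-↭)
import Data.Nat.Properties as ℕ
open import Data.Product.Base using (_×_; _,_; proj₁; proj₂; ∃-syntax)
open import Data.Product.Properties using (,-injective)
open import Data.Sum.Base using (_⊎_; inj₁; inj₂)
open import Data.Unit.Base using (⊤; tt)
open import Function.Base using (flip; _∘_)
open import Function.Bundles using (_⇔_; mk⇔)
open import Function.Properties.Equivalence using () renaming (sym to ⇔-sym; trans to ⇔-trans)
open import Level using (Level; 0ℓ)
open import Relation.Binary.Construct.Flip.EqAndOrd using (decTotalOrder)
open import Relation.Binary.PropositionalEquality as ≡ using (_≡_; _≢_)
open import Relation.Nullary.Decidable using (Dec; yes; no; _⊎-dec_; from-no; toSum)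
open import Relation.Nullary.Negation using (¬_; contradiction)

-- A ring solver with integer coefficients

-- In C, the half a chosen after σ others excludes a+σ, a+σ+1 and a+σ+2, and the next bound
-- (a+2)+(σ+1) lies just beyond this window: the shift does all the work. In B the next bound a+2 is
-- itself the last excluded value, so one value must be forbidden. A shift that grows without limit
-- is thus to be matched with a flag that is set and cleared. They agree (`V-noSingle`) because the
-- part a+σ+1 is reached equally by raising a or by raising σ.
--
-- Nilpotency replaces every limit: 1 - q^k with k > 0 can be cancelled, recurrences are followed
-- upwards until all values are constant, and a series identity becomes a polynomial identity
-- between n-th terms together with a telescoping sequence that vanishes at both ends.
--
-- The product for A is taken in blocks of seven consecutive exponents, which is why the bounds M
-- and 7M occur side by side.

module IntegerCoefficients {c ℓ : Level} (R : CommutativeRing c ℓ) where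
  open CommutativeRing R
  open import Algebra.Properties.Ring ring
  open import Algebra.Properties.Semiring.Mult.TCOptimised semiring
    using (1+×; ×-homo-+; ×1-homo-*) renaming (_×_ to _times_)
  open import Algebra.Solver.Ring.AlmostCommutativeRing
    using (fromCommutativeRing; _-Raw-AlmostCommutative⟶_)
  open import Relation.Binary.Reasoning.Setoid setoid

  -- With this form of the multiple, `ι 0ℤ` and `ι 1ℤ` reduce to `0#` and `1#`, so solver
  -- expressions match goals containing these constants literally.
  ι : ℤ → Carrier
  ι (+ n)    = n times 1#
  ι -[1+ n ] = - (suc n times 1#)

  shift-difference : ∀ x y z → y - z ≈ (x + y) - (x + z)
  shift-difference x y z = begin
    y - z                    ≈⟨ +-congʳ (+-identityˡ y) ⟨
    0# + y - z               ≈⟨ +-congʳ (+-congʳ (-‿inverseˡ x)) ⟨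
    - x + x + y - z          ≈⟨ +-congʳ (+-assoc (- x) x y) ⟩
    - x + (x + y) - z        ≈⟨ +-congʳ (+-comm (- x) (x + y)) ⟩
    (x + y) - x - z          ≈⟨ +-assoc (x + y) (- x) (- z) ⟩
    (x + y) + (- x - z)      ≈⟨ +-congˡ (-‿+-comm x z) ⟩
    (x + y) - (x + z)        ∎

  ι-⊖ : ∀ m n → ι (m ℤ.⊖ n) ≈ m times 1# - n times 1#
  ι-⊖ m zero = sym (trans (+-congˡ -0#≈0#) (+-identityʳ _))
  ι-⊖ zero (suc n) = sym (+-identityˡ _)
  ι-⊖ (suc m) (suc n) = begin
    ι (suc m ℤ.⊖ suc n)                    ≡⟨ ≡.cong ι (ℤ.[1+m]⊖[1+n]≡m⊖n m n) ⟩
    ι (m ℤ.⊖ n)                            ≈⟨ ι-⊖ m n ⟩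
    m times 1# - n times 1#                ≈⟨ shift-difference 1# _ _ ⟩
    (1# + m times 1#) - (1# + n times 1#)  ≈⟨ +-cong (1+× m 1#) (-‿cong (1+× n 1#)) ⟨
    suc m times 1# - suc n times 1#        ∎

  ι-neg : ∀ i → ι (ℤ.- i) ≈ - ι i
  ι-neg (+ zero)   = sym -0#≈0#
  ι-neg (+ suc n)  = refl
  ι-neg -[1+ n ]   = sym (-‿involutive _)

  ι-+ : ∀ i j → ι (i ℤ.+ j) ≈ ι i + ι j
  ι-+ (+ m)    (+ n)    = ×-homo-+ 1# m n
  ι-+ (+ m)    -[1+ n ] = ι-⊖ m (suc n)
  ι-+ -[1+ m ] (+ n)    = trans (ι-⊖ n (suc m)) (+-comm _ _)
  ι-+ -[1+ m ] -[1+ n ] = begin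
    - (suc (suc (m ℕ.+ n)) times 1#)          ≡⟨ ≡.cong (λ k → - (suc k times 1#)) (ℕ.+-suc m n) ⟨
    - ((suc m ℕ.+ suc n) times 1#)            ≈⟨ -‿cong (×-homo-+ 1# (suc m) (suc n)) ⟩
    - (suc m times 1# + suc n times 1#)       ≈⟨ -‿+-comm _ _ ⟨
    - (suc m times 1#) - (suc n times 1#)     ∎

  ι-*-pos : ∀ m n → ι (+ m ℤ.* + n) ≈ ι (+ m) * ι (+ n)
  ι-*-pos m n = trans (reflexive (≡.cong ι (≡.sym (ℤ.pos-* m n)))) (×1-homo-* m n)

  ι-*-posˡ : ∀ m j → ι (+ m ℤ.* j) ≈ ι (+ m) * ι j
  ι-*-posˡ m (+ n)    = ι-*-pos m n
  ι-*-posˡ m -[1+ n ] = begin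
    ι (+ m ℤ.* ℤ.- + suc n)      ≡⟨ ≡.cong ι (ℤ.neg-distribʳ-* (+ m) (+ suc n)) ⟨
    ι (ℤ.- (+ m ℤ.* + suc n))    ≈⟨ ι-neg (+ m ℤ.* + suc n) ⟩
    - ι (+ m ℤ.* + suc n)        ≈⟨ -‿cong (ι-*-pos m (suc n)) ⟩
    - (ι (+ m) * ι (+ suc n))    ≈⟨ -‿distribʳ-* _ _ ⟩
    ι (+ m) * ι -[1+ n ]         ∎

  ι-* : ∀ i j → ι (i ℤ.* j) ≈ ι i * ι j
  ι-* (+ m)    j = ι-*-posˡ m j
  ι-* -[1+ m ] j = begin
    ι (ℤ.- + suc m ℤ.* j)        ≡⟨ ≡.cong ι (ℤ.neg-distribˡ-* (+ suc m) j) ⟨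
    ι (ℤ.- (+ suc m ℤ.* j))      ≈⟨ ι-neg (+ suc m ℤ.* j) ⟩
    - ι (+ suc m ℤ.* j)          ≈⟨ -‿cong (ι-*-posˡ (suc m) j) ⟩
    - (ι (+ suc m) * ι j)        ≈⟨ -‿distribˡ-* _ _ ⟩
    ι -[1+ m ] * ι j             ∎

  ι-morphism : ℤ.+-*-rawRing -Raw-AlmostCommutative⟶ fromCommutativeRing R
  ι-morphism = record
    { ⟦_⟧    = ι
    ; +-homo = ι-+
    ; *-homo = ι-*
    ; -‿homo = ι-neg
    ; 0-homo = refl
    ; 1-homo = refl
    }

  _≟ι_ : ∀ i j → Maybe (ι i ≈ ι j)
  i ≟ι j with i ℤ.≟ j
  ... | yes ≡.refl = just refl
  ... | no _       = nothing

  open import Algebra.Solver.Ring ℤ.+-*-rawRing (fromCommutativeRing R) ι-morphism _≟ι_ public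
    using (solve; _:=_; _:+_; _:*_; _:-_; :-_; con; _:^_)

-- Identities in a ring with a nilpotent element

module SumsAndProducts {c ℓ : Level} (R : CommutativeRing c ℓ) where
  open CommutativeRing R
  open IntegerCoefficients R
  open import Relation.Binary.Reasoning.Setoid setoid

  Σ : (ℕ → Carrier) → ℕ → Carrier
  Σ f zero    = 0#
  Σ f (suc n) = Σ f n + f n

  Π : (ℕ → Carrier) → ℕ → Carrier
  Π f zero    = 1#
  Π f (suc n) = Π f n * f n

  Σ-cong : ∀ {f g} → (∀ n → f n ≈ g n) → ∀ n → Σ f n ≈ Σ g n
  Σ-cong f≈g zero    = refl
  Σ-cong f≈g (suc n) = +-cong (Σ-cong f≈g n) (f≈g n)

  Σ-+ : ∀ f g n → Σ (λ i → f i + g i) n ≈ Σ f n + Σ g n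
  Σ-+ f g zero    = sym (+-identityˡ 0#)
  Σ-+ f g (suc n) = trans (+-congʳ (Σ-+ f g n))
    (solve 4 (λ a b c d → (a :+ b) :+ (c :+ d) := (a :+ c) :+ (b :+ d)) refl _ _ _ _)

  Σ-*ˡ : ∀ x f n → Σ (λ i → x * f i) n ≈ x * Σ f n
  Σ-*ˡ x f zero    = sym (zeroʳ x)
  Σ-*ˡ x f (suc n) = trans (+-congʳ (Σ-*ˡ x f n)) (sym (distribˡ x _ _))

  Σ-telescope : ∀ {f g : ℕ → Carrier} (h : ℕ → Carrier) → (∀ n → f n + h (suc n) ≈ g n + h n) →
                ∀ n → Σ f n + h n ≈ Σ g n + h 0
  Σ-telescope h eq zero = refl
  Σ-telescope {f} {g} h eq (suc n) = begin
    Σ f n + f n + h (suc n)    ≈⟨ +-assoc _ _ _ ⟩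
    Σ f n + (f n + h (suc n))  ≈⟨ +-congˡ (eq n) ⟩
    Σ f n + (g n + h n)        ≈⟨ solve 3 (λ a b c → a :+ (b :+ c) := (a :+ c) :+ b) refl _ _ _ ⟩
    Σ f n + h n + g n          ≈⟨ +-congʳ (Σ-telescope {f} {g} h eq n) ⟩
    Σ g n + h 0 + g n          ≈⟨ solve 3 (λ a b c → (a :+ c) :+ b := (a :+ b) :+ c) refl _ _ _ ⟩
    Σ g n + g n + h 0          ∎

  -- The form in which the recurrences for series are proved below: `h` is a certificate for the
  -- termwise difference.
  Σ-telescope₀ : ∀ {f g : ℕ → Carrier} (h : ℕ → Carrier) → (∀ n → f n + h (suc n) ≈ g n + h n) → h 0 ≈ 0# →
                 ∀ n → h n ≈ 0# → Σ f n ≈ Σ g n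
  Σ-telescope₀ {f} {g} h eq h0 n hn = begin
    Σ f n        ≈⟨ +-identityʳ _ ⟨
    Σ f n + 0#   ≈⟨ +-congˡ hn ⟨
    Σ f n + h n  ≈⟨ Σ-telescope {f} {g} h eq n ⟩
    Σ g n + h 0  ≈⟨ +-congˡ h0 ⟩
    Σ g n + 0#   ≈⟨ +-identityʳ _ ⟩
    Σ g n        ∎

  Σ-head : ∀ f {n} → 0 < n → (∀ i → f (suc i) ≈ 0#) → Σ f n ≈ f 0
  Σ-head f {suc zero}        _ f≈0 = +-identityˡ _
  Σ-head f {suc n@(suc n-1)} _ f≈0 = trans (+-cong (Σ-head f ℕ.z<s f≈0) (f≈0 n-1)) (+-identityʳ _)

  Π-cong : ∀ {f g} → (∀ n → f n ≈ g n) → ∀ n → Π f n ≈ Π g n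
  Π-cong f≈g zero    = refl
  Π-cong f≈g (suc n) = *-cong (Π-cong f≈g n) (f≈g n)

  Π-* : ∀ f g n → Π (λ i → f i * g i) n ≈ Π f n * Π g n
  Π-* f g zero    = sym (*-identityˡ 1#)
  Π-* f g (suc n) = trans (*-congʳ (Π-* f g n))
    (solve 4 (λ a b c d → (a :* b) :* (c :* d) := (a :* c) :* (b :* d)) refl _ _ _ _)

  Π-peel : ∀ f n → Π f (suc n) ≈ f 0 * Π (λ i → f (suc i)) n
  Π-peel f zero    = *-comm _ _
  Π-peel f (suc n) = trans (*-congʳ (Π-peel f n)) (*-assoc _ _ _)

  Π-one : ∀ f n → (∀ i → f i ≈ 1#) → Π f n ≈ 1#
  Π-one f zero    f≈1 = refl
  Π-one f (suc n) f≈1 = trans (*-cong (Π-one f n f≈1) (f≈1 n)) (*-identityˡ 1#)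

  Π-stable : ∀ f n d → (∀ i → f (i ℕ.+ n) ≈ 1#) → Π f (d ℕ.+ n) ≈ Π f n
  Π-stable f n zero    f≈1 = refl
  Π-stable f n (suc d) f≈1 = trans (*-cong (Π-stable f n d f≈1) (f≈1 d)) (*-identityʳ _)

-- q-products and cancellation for nilpotent q

module QSeries {c ℓ : Level} (R : CommutativeRing c ℓ) where
  open CommutativeRing R
  open IntegerCoefficients R
  open SumsAndProducts R
  open import Algebra.Properties.Semiring.Exp semiring using (_^_; ^-homo-*; ^-congʳ; ^-assocʳ)
  open import Relation.Binary.Reasoning.Setoid setoid

  Nilpotent : Carrier → ℕ → Set ℓ
  Nilpotent q N = ∀ n → N ≤ n → q ^ n ≈ 0#

  1^n≈1 : ∀ n → 1# ^ n ≈ 1#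
  1^n≈1 zero    = refl
  1^n≈1 (suc n) = trans (*-identityˡ _) (1^n≈1 n)

  1-0≈1 : ∀ {x} → x ≈ 0# → 1# - x ≈ 1#
  1-0≈1 x≈0 = trans (+-congˡ (-‿cong x≈0)) (solve 0 (con (+ 1) :- con (+ 0) := con (+ 1)) refl)

  module _ (M : ℕ) where
    -- (q^k; q)_∞: the omitted factors are 1 under Nilpotent q M.
    E : Carrier → ℕ → Carrier
    E q k = Π (λ i → 1# - q ^ (i ℕ.+ k)) M

    module _ {q : Carrier} (q-nil : Nilpotent q M) where
      E-step : ∀ k → E q k ≈ (1# - q ^ k) * E q (suc k)
      E-step k = begin
        Π f M                               ≈⟨ *-identityʳ _ ⟨
        Π f M * 1#                          ≈⟨ *-congˡ (1-0≈1 (q-nil _ (ℕ.m≤m+n M k))) ⟨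
        Π f (suc M)                         ≈⟨ Π-peel f M ⟩
        (1# - q ^ k) * Π (λ i → f (suc i)) M
          ≈⟨ *-congˡ (Π-cong (λ i → +-congˡ (-‿cong (^-congʳ q (≡.sym (ℕ.+-suc i k))))) M) ⟩
        (1# - q ^ k) * E q (suc k)          ∎
        where
        f : ℕ → Carrier
        f i = 1# - q ^ (i ℕ.+ k)

      E-one : ∀ {k} → M ≤ k → E q k ≈ 1#
      E-one M≤k = Π-one _ M (λ i → 1-0≈1 (q-nil _ (ℕ.≤-trans M≤k (ℕ.m≤n+m _ i))))

      -- In the summation formulas this is the convention 1/(q;q)_(-1) = 0, and it removes boundary
      -- terms at n = 0.
      E-zero : E q 0 ≈ 0#
      E-zero = trans (E-step 0) (solve 1 (λ x → (con (+ 1) :- con (+ 1)) :* x := con (+ 0)) refl _)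

      -- A geometric series: for z = q^k, iterating x = (1 - z) x + z x gives x = y + z^n (x - y),
      -- and z^M is a power of q with exponent kM ≥ M.
      cancel : ∀ {k} → 0 < k → ∀ {x y} → (1# - q ^ k) * x ≈ (1# - q ^ k) * y → x ≈ y
      cancel {k} 0<k {x} {y} eq = begin
        x                          ≈⟨ go M x y eq ⟩
        y + (q ^ k) ^ M * (x - y)  ≈⟨ +-congˡ (*-congʳ
            (trans (^-assocʳ q k M) (q-nil _ (ℕ.m≤n*m M k {{ℕ.>-nonZero 0<k}})))) ⟩
        y + 0# * (x - y)           ≈⟨ solve 2 (λ x y → y :+ con (+ 0) :* x := y) refl _ _ ⟩
        y                          ∎
        where
        go : ∀ n x y → (1# - q ^ k) * x ≈ (1# - q ^ k) * y → x ≈ y + (q ^ k) ^ n * (x - y)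
        go zero x y eq = solve 2 (λ x y → x := y :+ con (+ 1) :* (x :- y)) refl x y
        go (suc n) x y eq = begin
          x                             ≈⟨ solve 2 (λ x z → x := (con (+ 1) :- z) :* x :+ z :* x) refl x z ⟩
          (1# - z) * x + z * x          ≈⟨ +-cong eq (*-congˡ (go n x y eq)) ⟩
          (1# - z) * y + z * (y + z ^ n * (x - y))
            ≈⟨ solve 4 (λ x y z w → (con (+ 1) :- z) :* y :+ z :* (y :+ w :* (x :- y)) :=
                y :+ (z :* w) :* (x :- y)) refl x y z (z ^ n) ⟩
          y + z ^ suc n * (x - y) ∎
          where
          z : Carrier
          z = q ^ k

      cancel-Π : ∀ d k → 0 < k → ∀ {x y} → Π (λ i → 1# - q ^ (i ℕ.+ k)) d * x ≈ Π
          (λ i → 1# - q ^ (i ℕ.+ k)) d * y → x ≈ y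
      cancel-Π zero    k 0<k {x} {y} eq = trans (sym (*-identityˡ x)) (trans eq (*-identityˡ y))
      cancel-Π (suc d) k 0<k eq = cancel (ℕ.≤-trans 0<k (ℕ.m≤n+m k d)) (cancel-Π d k 0<k
        (trans (sym (*-assoc _ _ _)) (trans eq (*-assoc _ _ _))))

      E-cancel : ∀ {k x y} → 0 < k → E q k * x ≈ E q k * y → x ≈ y
      E-cancel {k} 0<k = cancel-Π M k 0<k

-- The recurrence for bipartitions

module Recurrences {c ℓ : Level} (R : CommutativeRing c ℓ) where
  open CommutativeRing R
  open IntegerCoefficients R
  open SumsAndProducts R
  open QSeries R
  open import Algebra.Properties.Semiring.Exp semiring using (_^_; ^-homo-*; ^-congʳ; ^-assocʳ)
  open import Relation.Binary.Reasoning.Setoid setoid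

  module Configurations (q : Carrier) where
    -- The first argument is fuel; the value 1 at `zero` is the contribution of the empty
    -- bipartition.
    V : ℕ → ℕ → ℕ → Carrier
    V zero    a σ = 1#
    V (suc k) a σ = V k (suc a) σ + (q ^ a * q ^ σ * V k (suc a) σ + q ^ a * q ^ a * V k (2 ℕ.+ a) (suc σ))

    V-one-step : ∀ {v w x y z} → x ≈ 0# → v ≈ 1# → v + (x * y * w + x * x * z) ≈ 1#
    V-one-step {v} {w} {x} {y} {z} x≈0 v≈1 = begin
      v + (x * y * w + x * x * z)     ≈⟨ +-cong v≈1
          (+-cong (*-congʳ (*-congʳ x≈0)) (*-congʳ (*-congʳ x≈0))) ⟩
      1# + (0# * y * w + 0# * x * z)
        ≈⟨ solve 4 (λ w x y z → con (+ 1) :+ (con (+ 0) :* y :* w :+ con (+ 0) :* x :* z) := con (+ 1))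
            refl w x y z ⟩
      1#                              ∎

    module _ {M : ℕ} (q-nil : Nilpotent q M) where
      V-one : ∀ k {a} σ → M ≤ a → V k a σ ≈ 1#
      V-one zero    σ M≤a = refl
      V-one (suc k) σ M≤a = V-one-step (q-nil _ M≤a) (V-one k σ (ℕ.m≤n⇒m≤1+n M≤a))

      -- Every step raises a by at least one, so when the fuel k is spent the bound has reached M,
      -- and any further choice has a weight divisible by q^M.
      V-fuel : ∀ k a σ → M ≤ k ℕ.+ a → V (suc k) a σ ≈ V k a σ
      V-fuel zero    a σ M≤a = V-one 1 σ M≤a
      V-fuel (suc k) a σ M≤  = +-cong v (+-cong (*-congˡ v) (*-congˡ (V-fuel k (2 ℕ.+ a) (suc σ)
          (ℕ.≤-trans M≤′ (ℕ.+-monoʳ-≤ k (ℕ.n≤1+n (suc a)))))))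
        where
        M≤′ : M ≤ k ℕ.+ suc a
        M≤′ = ≡.subst (M ≤_) (≡.sym (ℕ.+-suc k a)) M≤
        v : V (suc k) (suc a) σ ≈ V k (suc a) σ
        v = V-fuel k (suc a) σ M≤′

      -- V with σ + 1 has a second reading: the part a + σ is forbidden instead of the
      -- bound for all later parts being raised.
      V-noSingle : ∀ k a σ → M ≤ k ℕ.+ a →
                   V (suc k) a (suc σ) ≈ V k (suc a) σ + q ^ a * q ^ a * V k (2 ℕ.+ a) (suc σ)
      V-noSingle zero a σ M≤a = trans (V-one 1 (suc σ) M≤a) (sym (begin
        1# + x * x * 1#   ≈⟨ +-congˡ (*-congʳ (*-congʳ (q-nil a M≤a))) ⟩
        1# + 0# * x * 1#  ≈⟨ solve 1 (λ x → con (+ 1) :+ con (+ 0) :* x :* con (+ 1) := con (+ 1)) refl x ⟩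
        1#                ∎))
        where
        x : Carrier
        x = q ^ a
      V-noSingle (suc k) a σ M≤ = begin
        V₁ + (x * (q * y) * V₁ + x * x * V₂)
          ≈⟨ +-cong ih₁ (+-cong (*-congˡ ih₁) (*-congˡ ih₂)) ⟩
        p + qx * qx * r + (x * (q * y) * (p + qx * qx * r) + x * x * (r + qqx * qqx * t))
          -- The right-hand side unfolds to the same monomials: the part a+σ+1 appears as q^a
          -- q^(σ+1) on the left and as q^(a+1) q^σ on the right.
          ≈⟨ solve 6 (λ x y q p r t →
               p :+ q :* x :* (q :* x) :* r :+ (x :* (q :* y) :* (p :+ q :* x :* (q :* x) :* r) :+ x :*
                   x :* (r :+ q :* (q :* x) :* (q :* (q :* x)) :* t)) :=
               p :+ (q :* x :* y :* p :+ q :* x :* (q :* x) :* r) :+ x :* x :*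
                   (r :+ (q :* (q :* x) :* (q :* y) :* r :+ q :* (q :* x) :* (q :* (q :* x)) :* t)))
                   refl x y q p r t ⟩
        p + (qx * y * p + qx * qx * r) + x * x * (r + (qqx * (q * y) * r + qqx * qqx * t)) ∎
        where
        M≤′ : M ≤ k ℕ.+ suc a
        M≤′ = ≡.subst (M ≤_) (≡.sym (ℕ.+-suc k a)) M≤
        x y qx qqx p r t V₁ V₂ : Carrier
        x = q ^ a
        y = q ^ σ
        qx = q * x
        qqx = q * (q * x)
        p = V k (2 ℕ.+ a) σ
        r = V k (3 ℕ.+ a) (suc σ)
        t = V k (4 ℕ.+ a) (2 ℕ.+ σ)
        V₁ = V (suc k) (suc a) (suc σ)
        V₂ = V (suc k) (2 ℕ.+ a) (2 ℕ.+ σ)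
        ih₁ : V₁ ≈ p + qx * qx * r
        ih₁ = V-noSingle k (suc a) σ M≤′
        ih₂ : V₂ ≈ r + qqx * qqx * t
        ih₂ = V-noSingle k (2 ℕ.+ a) (suc σ) (ℕ.≤-trans M≤′ (ℕ.+-monoʳ-≤ k (ℕ.n≤1+n (suc a))))

      W : ℕ → Carrier
      W a = V M a 0

      -- By `V-noSingle` and the definition of `V`, V(a+2,1) and W(a+2) differ only by q^(a+2)
      -- W(a+3), the contribution of the part a+2. Substituting this removes σ = 1.
      W-recurrence : ∀ a → let x = q ^ a in
        W a ≈ W (1 ℕ.+ a) + x * W (1 ℕ.+ a) + x * x * (W (2 ℕ.+ a) - q * (q * x) * W (3 ℕ.+ a))
      W-recurrence a = begin
        V M a 0        ≈⟨ V-fuel M a 0 M≤ ⟨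
        V (suc M) a 0  ≈⟨ +-congˡ (+-congˡ (*-congˡ noSingle)) ⟩
        w₁ + (x * 1# * w₁ + x * x * (w₂ - q * (q * x) * w₃))
          ≈⟨ solve 5 (λ q x w₁ w₂ w₃ → w₁ :+ (x :* con (+ 1) :* w₁ :+ x :* x :*
              (w₂ :- q :* (q :* x) :* w₃)) :=
             w₁ :+ x :* w₁ :+ x :* x :* (w₂ :- q :* (q :* x) :* w₃)) refl q x w₁ w₂ w₃ ⟩
        w₁ + x * w₁ + x * x * (w₂ - q * (q * x) * w₃) ∎
        where
        x w₁ w₂ w₃ v : Carrier
        x = q ^ a
        w₁ = W (1 ℕ.+ a)
        w₂ = W (2 ℕ.+ a)
        w₃ = W (3 ℕ.+ a)
        v = V M (4 ℕ.+ a) 1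
        M≤ : ∀ {b} → M ≤ M ℕ.+ b
        M≤ = ℕ.m≤m+n M _
        noSingle : V M (2 ℕ.+ a) 1 ≈ w₂ - q * (q * x) * w₃
        noSingle = begin
          V M (2 ℕ.+ a) 1        ≈⟨ V-fuel M (2 ℕ.+ a) 1 M≤ ⟨
          V (suc M) (2 ℕ.+ a) 1  ≈⟨ V-noSingle M (2 ℕ.+ a) 0 M≤ ⟩
          w₃ + q ^ (2 ℕ.+ a) * q ^ (2 ℕ.+ a) * v
            ≈⟨ solve 3 (λ z w₃ v → w₃ :+ z :* z :* v :=
                w₃ :+ (z :* con (+ 1) :* w₃ :+ z :* z :* v) :- z :* w₃) refl (q ^ (2 ℕ.+ a)) w₃ v ⟩
          V (suc M) (2 ℕ.+ a) 0 - q ^ (2 ℕ.+ a) * w₃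
            ≈⟨ +-congʳ (V-fuel M (2 ℕ.+ a) 0 M≤) ⟩
          w₂ - q * (q * x) * w₃  ∎

-- The Andrews-Gordon series for k = 3

module AndrewsGordon {c ℓ : Level} (R : CommutativeRing c ℓ) where
  open CommutativeRing R
  open IntegerCoefficients R
  open SumsAndProducts R
  open QSeries R
  open Recurrences R
  open import Algebra.Properties.Semiring.Exp semiring using (_^_; ^-homo-*; ^-congʳ; ^-congˡ)
  open import Relation.Binary.Reasoning.Setoid setoid

  module Theta (q : Carrier) where
    -- This is (-1)^n q^(7n(n-1)/2 + 3mn), built from quotients of successive terms so that no
    -- exponent has to be halved.
    κ : ℕ → ℕ → Carrier
    κ m zero    = 1#
    κ m (suc n) = - (κ m n * ((q ^ n) ^ 7 * (q ^ m) ^ 3))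

    -- The terms n and -n-1 of the two-sided series Σ (-1)^n q^(n(7n+5)/2), taken together.
    θ : ℕ → Carrier
    θ n = κ 0 n * (q ^ n) ^ 6 * (1# - q * (q ^ n * q ^ n))

    κ-suc : ∀ m n → κ (suc m) n ≈ κ m n * (q ^ n) ^ 3
    κ-suc m zero    = solve 0 (con (+ 1) := con (+ 1) :* con (+ 1) :^ 3) refl
    κ-suc m (suc n) = begin
      - (κ (suc m) n * (y ^ 7 * (q * x) ^ 3))   ≈⟨ -‿cong (*-congʳ (κ-suc m n)) ⟩
      - (κ m n * y ^ 3 * (y ^ 7 * (q * x) ^ 3))
        ≈⟨ solve 4 (λ k q x y → :- (k :* y :^ 3 :* (y :^ 7 :* (q :* x) :^ 3)) := :-
            (k :* (y :^ 7 :* x :^ 3)) :* (q :* y) :^ 3) refl (κ m n) q x y ⟩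
      - (κ m n * (y ^ 7 * x ^ 3)) * (q * y) ^ 3 ∎
      where
      x y : Carrier
      x = q ^ m
      y = q ^ n

  module _ (q : Carrier) (M : ℕ) where
    open Theta q

    F : ℕ → Carrier
    F n = Π (λ i → 1# - q ^ suc i) n

    -- With x = q^m and j = 7 - i, the sum over n is (q;q)_∞² times Andrews' series
    --   J_{3,i}(x) = Σ_n (-1)^n x^(3n) q^(7n(n+1)/2-in) (1 - x^i q^((2n+1)i)) / ((q)_n (xq^(n+1))_∞),
    -- the factor (q;q)_∞² turning both denominators into products.
    term : ℕ → ℕ → ℕ → ℕ → Carrier
    term i j m n = κ m n * (q ^ n) ^ j * (1# - (q * q ^ m * (q ^ n * q ^ n)) ^ i) *
        (E M q (suc n) * F (n ℕ.+ m))

    H₁ H₂ H₃ : ℕ → Carrier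
    H₁ m = Σ (term 1 6 m) M
    H₂ m = Σ (term 2 5 m) M
    H₃ m = Σ (term 3 4 m) M

    module _ (q-nil : Nilpotent q M) where

      F-suc : ∀ n m → F (n ℕ.+ suc m) ≈ F (n ℕ.+ m) * (1# - q * (q ^ n * q ^ m))
      F-suc n m = trans (reflexive (≡.cong F (ℕ.+-suc n m)))
        (*-congˡ (+-congˡ (-‿cong (*-congˡ (^-homo-* q n m)))))

      -- The classical argument lets a factor 1 - q^n turn 1/(q;q)_n into 1/(q;q)_(n-1) and then
      -- replaces n by n+1 in these terms. They are collected here, so that the change of index
      -- becomes telescoping.
      carry : ℕ → ℕ → ℕ → Carrier
      carry j m n = κ m n * (q ^ n) ^ j * (E M q n * F (n ℕ.+ m))

      carry-zero : ∀ j m → carry j m 0 ≈ 0#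
      carry-zero j m = trans (*-congˡ (*-congʳ (E-zero M q-nil)))
        (solve 2 (λ a b → a :* (con (+ 0) :* b) := con (+ 0)) refl _ _)

      carry-end : ∀ j m → carry (suc j) m M ≈ 0#
      carry-end j m = trans (*-congʳ (*-congˡ (*-congʳ (q-nil M ℕ.≤-refl))))
        (solve 3 (λ a b c → a :* (con (+ 0) :* b) :* c := con (+ 0)) refl _ _ _)

      module Step (m n : ℕ) where
        x y k e φ : Carrier
        x = q ^ m
        y = q ^ n
        k = κ m n
        e = E M q (suc n)
        φ = F (n ℕ.+ m)

        carry≈ : ∀ j → carry j m n ≈ k * y ^ j * ((1# - y) * e * φ)
        carry≈ j = *-congˡ (*-congʳ (E-step M q-nil n))

        carry-suc≈ : ∀ j → carry j m (suc n) ≈ - (k * (y ^ 7 * x ^ 3)) * (q * y) ^ j *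
            (e * (φ * (1# - q * (y * x))))
        carry-suc≈ j = *-congˡ (*-congˡ (*-congˡ (+-congˡ (-‿cong (*-congˡ (^-homo-* q n m))))))

        term-suc≈ : ∀ i j → term i j (suc m) n ≈
          k * y ^ 3 * y ^ j * (1# - (q * (q * x) * (y * y)) ^ i) * (e * (φ * (1# - q * (y * x))))
        term-suc≈ i j = *-cong (*-congʳ (*-congʳ (κ-suc m n))) (*-congˡ (F-suc n m))

      -- With J_i for J_{3,i}, this and the next two recurrences are the cases i = 1, 2, 3 of J_i(x)
      -- - J_(i-1)(x) = (xq)^(i-1) J_(4-i)(xq), where J_0 = 0.
      H₁-recurrence : ∀ m → H₁ m ≈ H₃ (suc m)
      H₁-recurrence m = Σ-telescope₀ (carry 6 m) step (carry-zero 6 m) M (carry-end 5 m)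
        where
        step : ∀ n → term 1 6 m n + carry 6 m (suc n) ≈ term 3 4 (suc m) n + carry 6 m n
        step n = begin
          term 1 6 m n + carry 6 m (suc n)       ≈⟨ +-congˡ (carry-suc≈ 6) ⟩
          _ ≈⟨ solve 6 (λ q x y k e φ →
                k :* y :^ 6 :* (con (+ 1) :- (q :* x :* (y :* y)) :^ 1) :* (e :* φ) :+
                :- (k :* (y :^ 7 :* x :^ 3)) :* (q :* y) :^ 6 :*
                    (e :* (φ :* (con (+ 1) :- q :* (y :* x)))) :=
                k :* y :^ 3 :* y :^ 4 :* (con (+ 1) :- (q :* (q :* x) :* (y :* y)) :^ 3) :*
                    (e :* (φ :* (con (+ 1) :- q :* (y :* x)))) :+
                k :* y :^ 6 :* ((con (+ 1) :- y) :* e :* φ)) refl q x y k e φ ⟩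
          _ ≈⟨ +-cong (term-suc≈ 3 4) (carry≈ 6) ⟨
          term 3 4 (suc m) n + carry 6 m n ∎
          where open Step m n

      H₂-recurrence : ∀ m → H₂ m ≈ H₁ m + q * q ^ m * H₂ (suc m)
      H₂-recurrence m = begin
        H₂ m  ≈⟨ Σ-telescope₀ (carry 5 m) step (carry-zero 5 m) M (carry-end 4 m) ⟩
        Σ (λ n → term 1 6 m n + q * q ^ m * term 2 5 (suc m) n) M ≈⟨ Σ-+ _ _ M ⟩
        H₁ m + Σ (λ n → q * q ^ m * term 2 5 (suc m) n) M ≈⟨ +-congˡ (Σ-*ˡ _ _ M) ⟩
        H₁ m + q * q ^ m * H₂ (suc m) ∎
        where
        step : ∀ n → term 2 5 m n + carry 5 m (suc n) ≈ term 1 6 m n + q * q ^ m * term 2 5 (suc m) n +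
            carry 5 m n
        step n = begin
          term 2 5 m n + carry 5 m (suc n)       ≈⟨ +-congˡ (carry-suc≈ 5) ⟩
          _ ≈⟨ solve 6 (λ q x y k e φ →
                k :* y :^ 5 :* (con (+ 1) :- (q :* x :* (y :* y)) :^ 2) :* (e :* φ) :+
                :- (k :* (y :^ 7 :* x :^ 3)) :* (q :* y) :^ 5 :*
                    (e :* (φ :* (con (+ 1) :- q :* (y :* x)))) :=
                k :* y :^ 6 :* (con (+ 1) :- (q :* x :* (y :* y)) :^ 1) :* (e :* φ) :+
                q :* x :* (k :* y :^ 3 :* y :^ 5 :* (con (+ 1) :- (q :* (q :* x) :* (y :* y)) :^ 2) :*
                    (e :* (φ :* (con (+ 1) :- q :* (y :* x))))) :+
                k :* y :^ 5 :* ((con (+ 1) :- y) :* e :* φ)) refl q x y k e φ ⟩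
          _ ≈⟨ +-cong (+-congˡ (*-congˡ (term-suc≈ 2 5))) (carry≈ 5) ⟨
          term 1 6 m n + q * q ^ m * term 2 5 (suc m) n + carry 5 m n ∎
          where open Step m n

      H₃-recurrence : ∀ m → H₃ m ≈ H₂ m + (q * q ^ m) ^ 2 * H₁ (suc m)
      H₃-recurrence m = begin
        H₃ m  ≈⟨ Σ-telescope₀ (carry 4 m) step (carry-zero 4 m) M (carry-end 3 m) ⟩
        Σ (λ n → term 2 5 m n + (q * q ^ m) ^ 2 * term 1 6 (suc m) n) M ≈⟨ Σ-+ _ _ M ⟩
        H₂ m + Σ (λ n → (q * q ^ m) ^ 2 * term 1 6 (suc m) n) M ≈⟨ +-congˡ (Σ-*ˡ _ _ M) ⟩
        H₂ m + (q * q ^ m) ^ 2 * H₁ (suc m) ∎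
        where
        step : ∀ n → term 3 4 m n + carry 4 m (suc n) ≈ term 2 5 m n + (q * q ^ m) ^ 2 * term 1 6
            (suc m) n + carry 4 m n
        step n = begin
          term 3 4 m n + carry 4 m (suc n)       ≈⟨ +-congˡ (carry-suc≈ 4) ⟩
          _ ≈⟨ solve 6 (λ q x y k e φ →
                k :* y :^ 4 :* (con (+ 1) :- (q :* x :* (y :* y)) :^ 3) :* (e :* φ) :+
                :- (k :* (y :^ 7 :* x :^ 3)) :* (q :* y) :^ 4 :*
                    (e :* (φ :* (con (+ 1) :- q :* (y :* x)))) :=
                k :* y :^ 5 :* (con (+ 1) :- (q :* x :* (y :* y)) :^ 2) :* (e :* φ) :+
                (q :* x) :^ 2 :* (k :* y :^ 3 :* y :^ 6 :*
                    (con (+ 1) :- (q :* (q :* x) :* (y :* y)) :^ 1) :*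
                    (e :* (φ :* (con (+ 1) :- q :* (y :* x))))) :+
                k :* y :^ 4 :* ((con (+ 1) :- y) :* e :* φ)) refl q x y k e φ ⟩
          _ ≈⟨ +-cong (+-congˡ (*-congˡ (term-suc≈ 1 6))) (carry≈ 4) ⟨
          term 2 5 m n + (q * q ^ m) ^ 2 * term 1 6 (suc m) n + carry 4 m n ∎
          where open Step m n

      F-stable : ∀ {m} → M ≤ m → F m ≈ F M
      F-stable {m} M≤m = trans (reflexive (≡.cong F (≡.sym (ℕ.m∸n+n≡m M≤m))))
        (Π-stable _ M (m ℕ.∸ M) λ i → 1-0≈1 (q-nil _ (ℕ.m≤n⇒m≤1+n (ℕ.m≤n+m M i))))

      E₁≈F : E M q 1 ≈ F M
      E₁≈F = Π-cong (λ i → +-congˡ (-‿cong (^-congʳ q (ℕ.+-comm i 1)))) M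

      E₁≈F*E : ∀ n → E M q 1 ≈ F n * E M q (suc n)
      E₁≈F*E zero    = sym (*-identityˡ _)
      E₁≈F*E (suc n) = trans (E₁≈F*E n) (trans (*-congˡ (E-step M q-nil (suc n))) (sym (*-assoc _ _ _)))

      module _ (0<M : 0 < M) where
        private
          c₀ : Carrier
          c₀ = E M q 1 * E M q 1

        -- For x = 0 only the summand n = 0 survives. These are the starting values from which the
        -- recurrences descend.
        term-base : ∀ i j m → M ≤ m → Σ (term (suc i) j m) M ≈ c₀
        term-base i j m M≤m = begin
          Σ (term (suc i) j m) M                         ≈⟨ Σ-head _ 0<M tail≈0 ⟩
          1# * 1# ^ j * (1# - (q * x * (1# * 1#)) ^ suc i) * (E M q 1 * F m)
            ≈⟨ *-cong (*-cong (*-congˡ (1^n≈1 j)) (1-0≈1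
                (trans (*-congʳ (trans (*-congʳ (*-congˡ x≈0))
                (solve 1 (λ q → q :* con (+ 0) :* (con (+ 1) :* con (+ 1)) := con (+ 0)) refl q)))
                (zeroˡ _))))
                      (*-congˡ (trans (F-stable M≤m) (sym E₁≈F))) ⟩
          1# * 1# * 1# * c₀
              ≈⟨ solve 1 (λ c → con (+ 1) :* con (+ 1) :* con (+ 1) :* c := c) refl c₀ ⟩
          c₀ ∎
          where
          x : Carrier
          x = q ^ m
          x≈0 : x ≈ 0#
          x≈0 = q-nil m M≤m
          κ≈0 : ∀ n → κ m (suc n) ≈ 0#
          κ≈0 n = trans (-‿cong (*-congˡ (*-congˡ (*-congʳ x≈0))))
            (solve 3 (λ a b c → :- (a :* (b :* (con (+ 0) :* c))) := con (+ 0)) refl _ _ _)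
          tail≈0 : ∀ n → term (suc i) j m (suc n) ≈ 0#
          tail≈0 n = trans (*-congʳ (*-congʳ (*-congʳ (κ≈0 n))))
            (solve 3 (λ a b c → con (+ 0) :* a :* b :* c := con (+ 0)) refl _ _ _)

        open Configurations q using (W; W-recurrence; V-one)

        -- The counterpart of J_2 when W is that of J_3: the recurrences give J_2(x) = J_3(x) -
        -- (xq)^2 J_1(xq), and J_1(xq) = J_3(xq^2).
        D : ℕ → Carrier
        D a = W q-nil a - q ^ a * q ^ a * W q-nil (2 ℕ.+ a)

        W-base : ∀ {a} → M ≤ a → W q-nil a ≈ 1#
        W-base = V-one q-nil M 0

        D-base : ∀ {a} → M ≤ a → D a ≈ 1#
        D-base M≤a = trans (+-cong (W-base M≤a) (-‿cong (*-congʳ (*-congʳ (q-nil _ M≤a)))))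
          (solve 2 (λ a b → con (+ 1) :- con (+ 0) :* a :* b := con (+ 1)) refl _ _)

        -- Downward induction on m from the range where both sides are constant, with k as the
        -- distance. `H₂ m` needs both claims at m+1; `H₃ m` needs `H₂ m` and the first claim at
        -- m+2.
        W-D≈H : ∀ k m → M ≤ k ℕ.+ m → (c₀ * W q-nil (suc m) ≈ H₃ m) × (c₀ * D (suc m) ≈ H₂ m)
        W-D≈H zero m M≤m =
            trans (*-congˡ (W-base (ℕ.m≤n⇒m≤1+n M≤m))) (trans (*-identityʳ c₀) (sym (term-base 2 4 m M≤m)))
          , trans (*-congˡ (D-base (ℕ.m≤n⇒m≤1+n M≤m))) (trans (*-identityʳ c₀) (sym (term-base 1 5 m M≤m)))
        W-D≈H (suc k) m M≤ = sym (begin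
            H₃ m                                 ≈⟨ H₃-recurrence m ⟩
            H₂ m + x ^ 2 * H₁ (suc m)            ≈⟨ +-cong D≈
                (*-congˡ (trans (H₁-recurrence (suc m)) (sym ih₂))) ⟩
            c₀ * (w - x * x * w₂) + x ^ 2 * (c₀ * w₂)
              ≈⟨ solve 4 (λ c x w w₂ → c :* (w :- x :* x :* w₂) :+ x :^ 2 :* (c :* w₂) := c :* w)
                  refl c₀ x w w₂ ⟩
            c₀ * w                               ∎)
          , sym D≈
          where
          x w w₁ w₂ w₃ : Carrier
          x = q * q ^ m
          w  = W q-nil (1 ℕ.+ m)
          w₁ = W q-nil (2 ℕ.+ m)
          w₂ = W q-nil (3 ℕ.+ m)
          w₃ = W q-nil (4 ℕ.+ m)
          M≤′ : M ≤ k ℕ.+ suc m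
          M≤′ = ≡.subst (M ≤_) (≡.sym (ℕ.+-suc k m)) M≤
          ih₁ : (c₀ * w₁ ≈ H₃ (suc m)) × (c₀ * (w₁ - q * x * (q * x) * w₃) ≈ H₂ (suc m))
          ih₁ = W-D≈H k (suc m) M≤′
          ih₂ : c₀ * w₂ ≈ H₃ (2 ℕ.+ m)
          ih₂ = proj₁ (W-D≈H k (2 ℕ.+ m) (ℕ.≤-trans M≤′ (ℕ.+-monoʳ-≤ k (ℕ.n≤1+n (suc m)))))
          D≈ : H₂ m ≈ c₀ * (w - x * x * w₂)
          D≈ = begin
            H₂ m                          ≈⟨ H₂-recurrence m ⟩
            H₁ m + x * H₂ (suc m)         ≈⟨ +-cong (trans (H₁-recurrence m) (sym (proj₁ ih₁)))
                (*-congˡ (sym (proj₂ ih₁))) ⟩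
            c₀ * w₁ + x * (c₀ * (w₁ - q * x * (q * x) * w₃))
              -- In terms of `D` the recurrence for `W` reads D(m+1) = W(m+2) + x D(m+2), which is
              -- the recurrence for `H₂`.
              ≈⟨ solve 6 (λ c q x w₁ w₂ w₃ → c :* w₁ :+ x :* (c :* (w₁ :- q :* x :* (q :* x) :* w₃)) :=
                 c :* (w₁ :+ x :* w₁ :+ x :* x :* (w₂ :- q :* (q :* x) :* w₃) :- x :* x :* w₂))
                     refl c₀ q x w₁ w₂ w₃ ⟩
            c₀ * (w₁ + x * w₁ + x * x * (w₂ - q * (q * x) * w₃) - x * x * w₂)
              ≈⟨ *-congˡ (+-congʳ (W-recurrence q-nil (suc m))) ⟨
            c₀ * (w - x * x * w₂)         ∎

        -- At x = 1 the two products are (q^(n+1);q)_∞ and (q;q)_n, and together they no longer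
        -- depend on n.
        H₁-0 : H₁ 0 ≈ E M q 1 * Σ θ M
        H₁-0 = trans (Σ-cong (λ n → begin
            term 1 6 0 n   ≈⟨ *-congˡ (trans (*-congˡ (reflexive (≡.cong F (ℕ.+-identityʳ n))))
                (trans (*-comm _ _) (sym (E₁≈F*E n)))) ⟩
            κ 0 n * (q ^ n) ^ 6 * (1# - (q * 1# * (q ^ n * q ^ n)) ^ 1) * E M q 1
              ≈⟨ solve 5 (λ k z q y e → k :* z :* (con (+ 1) :- (q :* con (+ 1) :* (y :* y)) :^ 1) :*
                  e := e :* (k :* z :* (con (+ 1) :- q :* (y :* y)))) refl _ _ _ _ _ ⟩
            E M q 1 * θ n  ∎) M)
          (Σ-*ˡ _ θ M)

        -- The lower bound 2 on halves and parts means x = q, and J_3(q) = J_1(1) leads to the point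
        -- x = 1, where the denominators merge.
        W₂≈θ : E M q 1 * W q-nil 2 ≈ Σ θ M
        W₂≈θ = E-cancel M q-nil (s≤s z≤n) (begin
          E M q 1 * (E M q 1 * W q-nil 2)   ≈⟨ *-assoc _ _ _ ⟨
          c₀ * W q-nil 2                    ≈⟨ proj₁ (W-D≈H M 1 (ℕ.m≤m+n M 1)) ⟩
          H₃ 1                              ≈⟨ H₁-recurrence 0 ⟨
          H₁ 0                              ≈⟨ H₁-0 ⟩
          E M q 1 * Σ θ M                   ∎)

-- The Jacobi triple product with base q^7

module JacobiTripleProduct {c ℓ : Level} (R : CommutativeRing c ℓ) where
  open CommutativeRing R
  open IntegerCoefficients R
  open SumsAndProducts R
  open QSeries R
  open AndrewsGordon R
  open import Algebra.Properties.Semiring.Exp semiring using (_^_; ^-homo-*; ^-congʳ; ^-congˡ; ^-assocʳ)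
  open import Algebra.Properties.CommutativeSemiring.Exp commutativeSemiring using (^-distrib-*)
  open import Relation.Binary.Reasoning.Setoid setoid

  -- Sums run to T and products in q^7 to M: the theta series will arrive with 7M terms, while the
  -- product is wanted over M blocks.
  module _ {q : Carrier} {M : ℕ} (q-nil : Nilpotent q M) {T : ℕ} (M≤T : M ≤ T) (0<T : 0 < T) where
    open Theta q

    Q : Carrier
    Q = q ^ 7

    ^7-comm : ∀ n → (q ^ n) ^ 7 ≈ Q ^ n
    ^7-comm n = begin
      (q ^ n) ^ 7    ≈⟨ ^-assocʳ q n 7 ⟩
      q ^ (n ℕ.* 7)  ≈⟨ ^-congʳ q (ℕ.*-comm n 7) ⟩
      q ^ (7 ℕ.* n)  ≈⟨ ^-assocʳ q 7 n ⟨
      Q ^ n          ∎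

    Q-nil : Nilpotent Q M
    Q-nil n M≤n = trans (^-assocʳ q 7 n) (q-nil _ (ℕ.≤-trans M≤n (ℕ.m≤n*m n 7)))

    e : ℕ → Carrier
    e = E M Q

    e-zero : e 0 ≈ 0#
    e-zero = E-zero M Q-nil

    e-zero-∸ : ∀ n → e (0 ℕ.∸ n) ≈ 0#
    e-zero-∸ n = trans (reflexive (≡.cong e (ℕ.0∸n≡0 n))) e-zero

    e-step : ∀ k → e k ≈ (1# - Q ^ k) * e (suc k)
    e-step = E-step M Q-nil

    -- For n ≤ b this is `e-step` at b - n, multiplied by Q^n. For n > b both truncated indices are
    -- 0, where `e` vanishes.
    e-difference : ∀ b n → Q ^ n * (e (suc b ℕ.∸ n) - e (b ℕ.∸ n)) ≈ Q ^ b * e (suc b ℕ.∸ n)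
    e-difference b zero = trans (*-congˡ (+-congˡ (-‿cong (e-step b))))
      (solve 2 (λ z x → con (+ 1) :* (x :- (con (+ 1) :- z) :* x) := z :* x) refl _ _)
    e-difference zero (suc n) = trans (*-congˡ (+-congʳ (e-zero-∸ n)))
      (trans (*-congˡ (+-congˡ (-‿cong e-zero)))
      (trans (solve 1 (λ z → z :* (con (+ 0) :- con (+ 0)) := con (+ 1) :* con (+ 0)) refl _)
      (*-congˡ (sym (e-zero-∸ n)))))
    e-difference (suc b) (suc n) = trans (*-assoc Q _ _)
        (trans (*-congˡ (e-difference b n)) (sym (*-assoc Q _ _)))

    -- Σ_n s b n = (Q;Q)_∞ Π_{i≥0} (1 - q Q^i) Π_{i<b} (1 - q^6 Q^i) for Q = q^7. The first
    -- summand vanishes for n > b, where the truncated subtraction yields e 0 ≈ 0.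
    s : ℕ → ℕ → Carrier
    s b n = κ 0 n * (q ^ n) ^ 6 * e (suc b ℕ.∸ n) - κ 0 n * (q ^ n) ^ 8 * q * e (n ℕ.+ (2 ℕ.+ b))

    S : ℕ → Carrier
    S b = Σ (s b) T

    y-nil : q ^ T ≈ 0#
    y-nil = q-nil T M≤T

    -- Behind `s` is a two-sided series with terms a_n(b), the second summand being the term -n-1.
    -- It satisfies a_n(b+1) = a_n(b) - q^6 Q^b a_(n-1)(b), by `e-difference` on one half and
    -- `e-step` on the other. The shift of n runs in opposite directions on the two halves and `h`
    -- records both; `h 0` vanishes because the term leaving one half enters the other.
    S-step : ∀ b → S (suc b) ≈ (1# - q ^ 6 * Q ^ b) * S b
    S-step b = trans (Σ-telescope₀ h step h₀ T hT) (Σ-*ˡ _ _ T)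
      where
      h : ℕ → Carrier
      h n = κ 0 n * (q ^ n) ^ 6 * (e (suc (suc b) ℕ.∸ n) - e (suc b ℕ.∸ n)) - q ^ 6 * Q ^ b *
          (κ 0 n * (q ^ n) ^ 8 * q * e (n ℕ.+ (2 ℕ.+ b)))
      h₀ : h 0 ≈ 0#
      h₀ = trans (+-congʳ (*-congˡ (+-congˡ (-‿cong (e-step (suc b))))))
        (solve 3 (λ q u x → con (+ 1) :* con (+ 1) :^ 6 :* (x :- (con (+ 1) :- q :^ 7 :* u) :* x) :-
            q :^ 6 :* u :* (con (+ 1) :* con (+ 1) :^ 8 :* q :* x) := con (+ 0)) refl q _ _)
      hT : h T ≈ 0#
      hT = trans (+-cong (*-congʳ (*-congˡ (^-congˡ 6 y-nil)))
          (-‿cong (*-congˡ (*-congʳ (*-congʳ (*-congˡ (^-congˡ 8 y-nil)))))))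
        (solve 5 (λ a b c d f → a :* con (+ 0) :^ 6 :* b :- c :* (a :* con (+ 0) :^ 8 :* d :* f) :=
            con (+ 0)) refl _ _ _ _ _)
      step : ∀ n → s (suc b) n + h (suc n) ≈ (1# - q ^ 6 * Q ^ b) * s b n + h n
      step n = begin
        t * y ^ 6 * e (suc (suc b) ℕ.∸ n) - t * y ^ 8 * q * e (n ℕ.+ (3 ℕ.+ b))
          + (- (t * (y ^ 7 * 1# ^ 3)) * (q * y) ^ 6 * (x₁ - x₀) - q ^ 6 * u *
              (- (t * (y ^ 7 * 1# ^ 3)) * (q * y) ^ 8 * q * e (suc (n ℕ.+ (2 ℕ.+ b)))))
          ≈⟨ +-congʳ (+-congˡ (-‿cong (*-congˡ (reflexive (≡.cong e (ℕ.+-suc n (2 ℕ.+ b))))))) ⟩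
        t * y ^ 6 * x₂ - t * y ^ 8 * q * z₁
          + (- (t * (y ^ 7 * 1# ^ 3)) * (q * y) ^ 6 * (x₁ - x₀) - q ^ 6 * u *
              (- (t * (y ^ 7 * 1# ^ 3)) * (q * y) ^ 8 * q * z₁))
          ≈⟨ solve 8 (λ q t y u x₀ x₁ x₂ z₁ →
              t :* y :^ 6 :* x₂ :- t :* y :^ 8 :* q :* z₁
               :+ (:- (t :* (y :^ 7 :* con (+ 1) :^ 3)) :* (q :* y) :^ 6 :* (x₁ :- x₀) :- q :^ 6 :* u :*
                   (:- (t :* (y :^ 7 :* con (+ 1) :^ 3)) :* (q :* y) :^ 8 :* q :* z₁)) :=
              t :* y :^ 6 :* x₂ :- q :^ 6 :* y :^ 6 :* t :* (y :^ 7 :* (x₁ :- x₀)) :- t :* y :^ 8 :* q :*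
                  ((con (+ 1) :- q :^ 14 :* u :* y :^ 7) :* z₁)) refl q t y u x₀ x₁ x₂ z₁ ⟩
        t * y ^ 6 * x₂ - q ^ 6 * y ^ 6 * t * (y ^ 7 * (x₁ - x₀)) - t * y ^ 8 * q *
            ((1# - q ^ 14 * u * y ^ 7) * z₁)
          ≈⟨ +-cong (+-congˡ (-‿cong (*-congˡ (trans (*-congʳ (^7-comm n)) (e-difference b n)))))
              (-‿cong (*-congˡ z-step)) ⟩
        t * y ^ 6 * x₂ - q ^ 6 * y ^ 6 * t * (u * x₁) - t * y ^ 8 * q * z₀
          ≈⟨ solve 7 (λ q t y u x₁ x₂ z₀ →
              t :* y :^ 6 :* x₂ :- q :^ 6 :* y :^ 6 :* t :* (u :* x₁) :- t :* y :^ 8 :* q :* z₀ :=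
              (con (+ 1) :- q :^ 6 :* u) :* (t :* y :^ 6 :* x₁ :- t :* y :^ 8 :* q :* z₀) :+
               (t :* y :^ 6 :* (x₂ :- x₁) :- q :^ 6 :* u :* (t :* y :^ 8 :* q :* z₀)))
                   refl q t y u x₁ x₂ z₀ ⟩
        (1# - q ^ 6 * u) * s b n + h n ∎
        where
        t y u x₀ x₁ x₂ z₀ z₁ : Carrier
        t = κ 0 n
        y = q ^ n
        u = Q ^ b
        x₀ = e (b ℕ.∸ n)
        x₁ = e (suc b ℕ.∸ n)
        x₂ = e (suc (suc b) ℕ.∸ n)
        z₀ = e (n ℕ.+ (2 ℕ.+ b))
        z₁ = e (suc (n ℕ.+ (2 ℕ.+ b)))
        z-step : (1# - q ^ 14 * u * y ^ 7) * z₁ ≈ z₀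
        z-step = begin
          (1# - q ^ 14 * u * y ^ 7) * z₁     ≈⟨ *-congʳ (+-congˡ (-‿cong (*-congˡ (^7-comm n)))) ⟩
          (1# - q ^ 14 * u * Q ^ n) * z₁     ≈⟨ *-congʳ
              (+-congˡ (-‿cong (solve 3 (λ q u v → q :^ 14 :* u :* v := v :* (q :^ 7 :* (q :^ 7 :* u)))
              refl q u (Q ^ n)))) ⟩
          (1# - Q ^ n * Q ^ (2 ℕ.+ b)) * z₁  ≈⟨ *-congʳ (+-congˡ (-‿cong (^-homo-* Q n (2 ℕ.+ b)))) ⟨
          (1# - Q ^ (n ℕ.+ (2 ℕ.+ b))) * z₁  ≈⟨ e-step (n ℕ.+ (2 ℕ.+ b)) ⟨
          z₀ ∎

    S-product : ∀ b → S b ≈ Π (λ i → 1# - q ^ 6 * Q ^ i) b * S 0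
    S-product zero    = sym (*-identityˡ _)
    S-product (suc b) = begin
      S (suc b)                                  ≈⟨ S-step b ⟩
      (1# - q ^ 6 * Q ^ b) * S b                 ≈⟨ *-congˡ (S-product b) ⟩
      (1# - q ^ 6 * Q ^ b) * (_ * S 0)           ≈⟨ solve 3 (λ a b c → a :* (b :* c) := b :* a :* c)
          refl _ _ _ ⟩
      Π (λ i → 1# - q ^ 6 * Q ^ i) (suc b) * S 0 ∎

    e-one : ∀ {k} → M ≤ k → e k ≈ 1#
    e-one = E-one M Q-nil

    -- The choice b = 2M leaves room: for n ≤ M the index b + 1 - n is still at least M, so `e` is 1
    -- there, and for n ≥ M the power (q^n)^6 vanishes.
    S-limit : S (M ℕ.+ M) ≈ Σ θ T
    S-limit = Σ-cong (λ n → begin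
      κ 0 n * (q ^ n) ^ 6 * e (suc (M ℕ.+ M) ℕ.∸ n) - κ 0 n * (q ^ n) ^ 8 * q * e (n ℕ.+ (2 ℕ.+ (M ℕ.+ M)))
        ≈⟨ +-cong (first n) (-‿cong (*-congˡ (e-one (M≤ n)))) ⟩
      κ 0 n * (q ^ n) ^ 6 - κ 0 n * (q ^ n) ^ 8 * q * 1#
        ≈⟨ solve 3 (λ t y q → t :* y :^ 6 :- t :* y :^ 8 :* q :* con (+ 1) :=
            t :* y :^ 6 :* (con (+ 1) :- q :* (y :* y))) refl _ _ _ ⟩
      θ n ∎) T
      where
      M≤ : ∀ n → M ≤ n ℕ.+ (2 ℕ.+ (M ℕ.+ M))
      M≤ n = ℕ.≤-trans (ℕ.m≤n+m M (2 ℕ.+ M)) (ℕ.m≤n+m _ n)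
      first : ∀ n → κ 0 n * (q ^ n) ^ 6 * e (suc (M ℕ.+ M) ℕ.∸ n) ≈ κ 0 n * (q ^ n) ^ 6
      first n with ℕ.≤-total M n
      ... | inj₁ M≤n = trans (*-congʳ z) (trans (zeroˡ _) (sym z))
        where
        z : κ 0 n * (q ^ n) ^ 6 ≈ 0#
        z = trans (*-congˡ (^-congˡ 6 (q-nil n M≤n)))
            (solve 1 (λ x → x :* con (+ 0) :^ 6 := con (+ 0)) refl _)
      ... | inj₂ n≤M = trans (*-congˡ (e-one (ℕ.≤-trans M≤1+M (ℕ.∸-monoʳ-≤ (suc (M ℕ.+ M)) n≤M))))
          (*-identityʳ _)
        where
        M≤1+M : M ≤ suc (M ℕ.+ M) ℕ.∸ M
        M≤1+M = ≡.subst (M ≤_) (≡.sym (ℕ.m+n∸n≡m (suc M) M)) (ℕ.n≤1+n M)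

    -- Euler's expansion: Σ_n p u n = (Q;Q)_∞ (q u;Q)_∞.
    p : Carrier → ℕ → Carrier
    p u n = κ 0 n * q ^ n * u ^ n * e (suc n)

    P : Carrier → Carrier
    P u = Σ (p u) T

    P-step : ∀ u → P u ≈ (1# - q * u) * P (Q * u)
    P-step u = trans (Σ-telescope₀ h step (trans (*-congˡ e-zero) (zeroʳ _)) T hT) (Σ-*ˡ _ _ T)
      where
      h : ℕ → Carrier
      h n = κ 0 n * q ^ n * u ^ n * e n
      hT : h T ≈ 0#
      hT = trans (*-congʳ (*-congʳ (*-congˡ y-nil)))
          (solve 3 (λ a b c → a :* con (+ 0) :* b :* c := con (+ 0)) refl _ _ _)
      -- Since 1 - Q^n turns `e (suc n)` into `e n`, the difference of `p u n` and `p (Q * u) n` is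
      -- `h n`; and `h (suc n)` is `p (Q * u) n` times -qu.
      step : ∀ n → p u n + h (suc n) ≈ (1# - q * u) * p (Q * u) n + h n
      step n = begin
        t * y * v * x + - (t * (y ^ 7 * 1# ^ 3)) * (q * y) * (u * v) * x
          ≈⟨ solve 6 (λ t y v x q u → t :* y :* v :* x :+ :- (t :* (y :^ 7 :* con (+ 1) :^ 3)) :*
              (q :* y) :* (u :* v) :* x :=
             (con (+ 1) :- q :* u) :* (t :* y :* (y :^ 7 :* v) :* x) :+ t :* y :* v :*
                 ((con (+ 1) :- y :^ 7) :* x)) refl t y v x q u ⟩
        (1# - q * u) * (t * y * (y ^ 7 * v) * x) + t * y * v * ((1# - y ^ 7) * x)
          ≈⟨ +-cong (*-congˡ (*-congʳ (*-congˡ (trans (*-congʳ (^7-comm n)) (sym (^-distrib-* Q u n))))))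
                    (*-congˡ (trans (*-congʳ (+-congˡ (-‿cong (^7-comm n)))) (sym (e-step n)))) ⟩
        (1# - q * u) * p (Q * u) n + h n ∎
        where
        t y v x : Carrier
        t = κ 0 n
        y = q ^ n
        v = u ^ n
        x = e (suc n)

    P-product : ∀ b → P 1# ≈ Π (λ i → 1# - q * Q ^ i) b * P (Q ^ b)
    P-product zero    = sym (*-identityˡ _)
    P-product (suc b) = trans (P-product b) (trans (*-congˡ (P-step (Q ^ b))) (sym (*-assoc _ _ _)))

    P-limit : P (Q ^ M) ≈ e 1
    P-limit = trans (Σ-head _ 0<T λ n → trans (*-congʳ (*-congˡ (*-congʳ (Q-nil M ℕ.≤-refl))))
        (solve 3 (λ a b c → a :* (con (+ 0) :* b) :* c := con (+ 0)) refl _ _ _))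
      (solve 1 (λ x → con (+ 1) :* con (+ 1) :* con (+ 1) :* x := x) refl _)

    -- The two series differ only in indexing: in `s 0 n` the first summand survives for n = 0
    -- alone, as the initial term of Euler's series, and the second is the term n+1 of that series.
    S₀≈P₁ : S 0 ≈ P 1#
    S₀≈P₁ = trans (Σ-telescope₀ h step h₀ T hT) (Σ-cong
        (λ n → *-congʳ (trans (sym (*-identityʳ _)) (*-congˡ (sym (1^n≈1 n))))) T)
      where
      h : ℕ → Carrier
      h n = κ 0 n * (q ^ n) ^ 6 * e (1 ℕ.∸ n) - κ 0 n * q ^ n * e (suc n)
      h₀ : h 0 ≈ 0#
      h₀ = solve 1 (λ x → con (+ 1) :* con (+ 1) :^ 6 :* x :- con (+ 1) :* con (+ 1) :* x := con (+ 0))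
          refl _
      hT : h T ≈ 0#
      hT = trans (+-cong (*-congʳ (*-congˡ (^-congˡ 6 y-nil))) (-‿cong (*-congʳ (*-congˡ y-nil))))
        (solve 3 (λ a b c → a :* con (+ 0) :^ 6 :* b :- a :* con (+ 0) :* c := con (+ 0)) refl _ _ _)
      step : ∀ n → s 0 n + h (suc n) ≈ κ 0 n * q ^ n * e (suc n) + h n
      step n = begin
        t * y ^ 6 * x - t * y ^ 8 * q * e (n ℕ.+ 2) +
            (- (t * (y ^ 7 * 1# ^ 3)) * (q * y) ^ 6 * e (0 ℕ.∸ n) - - (t * (y ^ 7 * 1# ^ 3)) * (q * y) * z)
          ≈⟨ +-cong (+-congˡ (-‿cong (*-congˡ (reflexive (≡.cong e (ℕ.+-comm n 2))))))
              (+-congʳ (*-congˡ (e-zero-∸ n))) ⟩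
        t * y ^ 6 * x - t * y ^ 8 * q * z + (- (t * (y ^ 7 * 1# ^ 3)) * (q * y) ^ 6 * 0# - -
            (t * (y ^ 7 * 1# ^ 3)) * (q * y) * z)
          ≈⟨ solve 6 (λ t y x q z w →
             t :* y :^ 6 :* x :- t :* y :^ 8 :* q :* z :+
                 (:- (t :* (y :^ 7 :* con (+ 1) :^ 3)) :* (q :* y) :^ 6 :* con (+ 0) :- :-
                 (t :* (y :^ 7 :* con (+ 1) :^ 3)) :* (q :* y) :* z) :=
             t :* y :* w :+ (t :* y :^ 6 :* x :- t :* y :* w)) refl t y x q z (e (suc n)) ⟩
        t * y * e (suc n) + h n ∎
        where
        t y x z : Carrier
        t = κ 0 n
        y = q ^ n
        x = e (1 ℕ.∸ n)
        z = e (2 ℕ.+ n)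

    θ-product : Σ θ T ≈ Π (λ i → (1# - q * Q ^ i) * (1# - q ^ 6 * Q ^ i) * (1# - Q * Q ^ i)) M
    θ-product = begin
      Σ θ T                    ≈⟨ S-limit ⟨
      S (M ℕ.+ M)              ≈⟨ S-product (M ℕ.+ M) ⟩
      Π f₆ (M ℕ.+ M) * S 0     ≈⟨ *-cong (Π-stable f₆ M M λ i → 1-0≈1
          (trans (*-congˡ (Q-nil _ (ℕ.m≤n+m M i))) (zeroʳ _)))
                                    (trans S₀≈P₁ (trans (P-product M) (*-congˡ (trans P-limit e₁)))) ⟩
      Π f₆ M * (Π f₁ M * Π f₇ M)  ≈⟨ solve 3 (λ a b c → a :* (b :* c) := b :* a :* c) refl _ _ _ ⟩
      Π f₁ M * Π f₆ M * Π f₇ M    ≈⟨ *-congʳ (Π-* f₁ f₆ M) ⟨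
      Π (λ i → f₁ i * f₆ i) M * Π f₇ M ≈⟨ Π-* _ f₇ M ⟨
      Π (λ i → f₁ i * f₆ i * f₇ i) M ∎
      where
      f₁ f₆ f₇ : ℕ → Carrier
      f₁ i = 1# - q * Q ^ i
      f₆ i = 1# - q ^ 6 * Q ^ i
      f₇ i = 1# - Q * Q ^ i
      e₁ : e 1 ≈ Π f₇ M
      e₁ = Π-cong (λ i → +-congˡ (-‿cong (^-congʳ Q (ℕ.+-comm i 1)))) M

-- Enumerating partitions and bipartitions

module Combinatorics where
  open Defs
  open import Data.Nat.Base using (_+_; _*_; _∸_)
  open import Relation.Binary.PropositionalEquality using (refl)
  open import Data.Nat.Tactic.RingSolver using (solve-∀)

  -- Partitions into parts of the admissible residues

  Allowed : ℕ → Set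
  Allowed p = (p ≡± 2 mod 7) ⊎ (p ≡± 3 mod 7)

  allowed? : ∀ p → Dec (Allowed p)
  allowed? p = ≡±? p 2 7 ⊎-dec ≡±? p 3 7

  onlyIf : {P X : Set} → Dec P → List X → List X
  onlyIf (yes _) xs = xs
  onlyIf (no _)  xs = []

  onlyIf-yes : {P X : Set} (P? : Dec P) {xs : List X} → P → onlyIf P? xs ≡ xs
  onlyIf-yes (yes _) _ = ≡.refl
  onlyIf-yes (no ¬p) p = contradiction p ¬p

  onlyIf-no : {P X : Set} (P? : Dec P) {xs : List X} → ¬ P → onlyIf P? xs ≡ []
  onlyIf-no (yes p) ¬p = contradiction p ¬p
  onlyIf-no (no _)  _  = ≡.refl

  ∈-onlyIf : {P X : Set} (P? : Dec P) {xs : List X} {x : X} → x ∈ onlyIf P? xs → P × x ∈ xs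
  ∈-onlyIf (yes p) x∈ = p , x∈

  onlyIf-unique : {P X : Set} (P? : Dec P) {xs : List X} → Unique xs → Unique (onlyIf P? xs)
  onlyIf-unique (yes _) u = u
  onlyIf-unique (no _)  _ = []

  -- f bounds the number of parts.
  partitions : ℕ → ℕ → List (List ℕ)
  partitions zero    f       = [ [] ]
  partitions (suc p) zero    = [ [] ]
  partitions (suc p) (suc f) =
    partitions p (suc f) ++ onlyIf (allowed? (suc p)) (map (suc p ∷_) (partitions (suc p) f))

  7∣r+i*7 : ∀ r i → 7 ∣ r → 7 ∣ r + i * 7
  7∣r+i*7 r i 7∣r = ∣m∣n⇒∣m+n 7∣r (n∣m*n i)

  7∤r+i*7 : ∀ r i → ¬ 7 ∣ r → ¬ 7 ∣ r + i * 7
  7∤r+i*7 r i 7∤r 7∣ = 7∤r (∣m+n∣m⇒∣n (≡.subst (7 ∣_) (ℕ.+-comm r _) 7∣) (n∣m*n i))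

  r+s+i*7 : ∀ r i s → r + s + i * 7 ≡ r + i * 7 + s
  r+s+i*7 = solve-∀

  7∣r+i*7+s : ∀ r i s → 7 ∣ r + s → 7 ∣ r + i * 7 + s
  7∣r+i*7+s r i s 7∣ = ≡.subst (7 ∣_) (r+s+i*7 r i s) (7∣r+i*7 (r + s) i 7∣)

  7∤r+i*7+s : ∀ r i s → ¬ 7 ∣ r + s → ¬ 7 ∣ r + i * 7 + s
  7∤r+i*7+s r i s 7∤ 7∣ = 7∤r+i*7 (r + s) i 7∤ (≡.subst (7 ∣_) (≡.sym (r+s+i*7 r i s)) 7∣)

  allowed₂ : ∀ i → Allowed (2 + i * 7)
  allowed₂ i = inj₁ (inj₁ (≡.subst (7 ∣_) (≡.sym (ℕ.∣-∣-identityʳ _)) (n∣m*n i)))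

  allowed₃ : ∀ i → Allowed (3 + i * 7)
  allowed₃ i = inj₂ (inj₁ (≡.subst (7 ∣_) (≡.sym (ℕ.∣-∣-identityʳ _)) (n∣m*n i)))

  allowed₄ : ∀ i → Allowed (4 + i * 7)
  allowed₄ i = inj₂ (inj₂ (7∣r+i*7+s 4 i 3 ∣-refl))

  allowed₅ : ∀ i → Allowed (5 + i * 7)
  allowed₅ i = inj₁ (inj₂ (7∣r+i*7+s 5 i 2 ∣-refl))

  ¬allowed : ∀ p → ¬ 7 ∣ ℕ.∣ p - 2 ∣ → ¬ 7 ∣ p + 2 → ¬ 7 ∣ ℕ.∣ p - 3 ∣ → ¬ 7 ∣ p + 3 → ¬ Allowed p
  ¬allowed p a b c d (inj₁ (inj₁ x)) = a x
  ¬allowed p a b c d (inj₁ (inj₂ x)) = b x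
  ¬allowed p a b c d (inj₂ (inj₁ x)) = c x
  ¬allowed p a b c d (inj₂ (inj₂ x)) = d x

  ¬allowed₁ : ∀ i → ¬ Allowed (1 + i * 7)
  -- The part 1 lies below 2 and 3, so its distances to them do not fit the pattern r + 7i that
  -- holds from 8 onwards.
  ¬allowed₁ zero    = from-no (allowed? 1)
  ¬allowed₁ (suc i) = ¬allowed (8 + i * 7) (7∤r+i*7 6 i (from-no (7 ∣? 6)))
      (7∤r+i*7+s 1 (suc i) 2 (from-no (7 ∣? 3)))
    (7∤r+i*7 5 i (from-no (7 ∣? 5))) (7∤r+i*7+s 1 (suc i) 3 (from-no (7 ∣? 4)))

  ¬allowed₆ : ∀ i → ¬ Allowed (6 + i * 7)
  ¬allowed₆ i = ¬allowed (6 + i * 7) (7∤r+i*7 4 i (from-no (7 ∣? 4))) (7∤r+i*7+s 6 i 2 (from-no (7 ∣? 8)))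
    (7∤r+i*7 3 i (from-no (7 ∣? 3))) (7∤r+i*7+s 6 i 3 (from-no (7 ∣? 9)))

  ¬allowed₇ : ∀ i → ¬ Allowed (7 + i * 7)
  ¬allowed₇ i = ¬allowed (7 + i * 7) (7∤r+i*7 5 i (from-no (7 ∣? 5))) (7∤r+i*7+s 7 i 2 (from-no (7 ∣? 9)))
    (7∤r+i*7 4 i (from-no (7 ∣? 4))) (7∤r+i*7+s 7 i 3 (from-no (7 ∣? 10)))

  IsPart : ℕ → ℕ → Set
  IsPart p y = 0 < y × y ≤ p × Allowed y

  data PartitionOrigin (p f : ℕ) : List ℕ → Set where
    smaller : ∀ {π} → π ∈ partitions p (suc f) → PartitionOrigin p f π
    equal   : ∀ {π} → Allowed (suc p) → π ∈ partitions (suc p) f → PartitionOrigin p f (suc p ∷ π)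

  partitionOrigin : ∀ p f {π} → π ∈ partitions (suc p) (suc f) → PartitionOrigin p f π
  partitionOrigin p f π∈ with ∈-++⁻ (partitions p (suc f)) π∈
  ... | inj₁ π∈₁ = smaller π∈₁
  ... | inj₂ π∈₂ with ∈-onlyIf (allowed? (suc p)) π∈₂
  ...   | al , π∈₃ with ∈-map⁻ (suc p ∷_) π∈₃
  ...     | _ , π∈₄ , refl = equal al π∈₄

  partitions-sound : ∀ p f {π} → π ∈ partitions p f → AllPairs _≥_ π × All (IsPart p) π
  partitions-sound zero    f       (here refl) = [] , []
  partitions-sound (suc p) zero    (here refl) = [] , []
  partitions-sound (suc p) (suc f) π∈ with partitionOrigin p f π∈
  ... | smaller π∈₁ = let d , parts = partitions-sound p (suc f) π∈₁ in
    d , All.map (λ (y> , y≤ , al) → y> , ℕ.m≤n⇒m≤1+n y≤ , al) parts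
  ... | equal al π∈₁ = let d , parts = partitions-sound (suc p) f π∈₁ in
    All.map (λ (_ , y≤ , _) → y≤) parts ∷ d , (ℕ.z<s , ℕ.≤-refl , al) ∷ parts

  -- Bounding the sum by f suffices, since every part counts at least 1 towards it.
  partitions-complete : ∀ p f {π} → AllPairs _≥_ π → All (IsPart p) π → sum π ≤ f → π ∈ partitions p f
  partitions-complete zero    f       {[]} _ _ _ = here refl
  partitions-complete zero    f       {_ ∷ _} _ ((y> , y≤ , _) ∷ _) _ = ⊥-elim (ℕ.<⇒≱ y> y≤)
  partitions-complete (suc p) zero    {[]} _ _ _ = here refl
  partitions-complete (suc p) zero    {y ∷ ys} _ ((y> , _) ∷ _) sum≤ =
      ⊥-elim (ℕ.<⇒≱ y> (ℕ.m+n≤o⇒m≤o y sum≤))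
  partitions-complete (suc p) (suc f) {[]} d parts sum≤ = ∈-++⁺ˡ (partitions-complete p (suc f) [] [] z≤n)
  partitions-complete (suc p) (suc f) {y ∷ ys} (ys≤ ∷ d) ((y> , y≤ , al) ∷ parts) sum≤ with y ℕ.≟ suc p
  ... | no y≢ = ∈-++⁺ˡ (partitions-complete p (suc f) (ys≤ ∷ d)
          ((y> , y≤p , al) ∷ All.zipWith (λ (z≤y , z> , _ , al′) → z> , ℕ.≤-trans z≤y y≤p , al′)
              (ys≤ , parts)) sum≤)
    where
    y≤p : y ≤ p
    y≤p = ℕ.s≤s⁻¹ (ℕ.≤∧≢⇒< y≤ y≢)
  ... | yes refl = ∈-++⁺ʳ (partitions p (suc f)) (≡.subst (_ ∈_) (≡.sym (onlyIf-yes (allowed? (suc p)) al))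
    (∈-map⁺ (suc p ∷_)
      (partitions-complete (suc p) f d parts (ℕ.≤-trans (ℕ.m≤n+m (sum ys) p) (ℕ.s≤s⁻¹ sum≤)))))

  partitions-unique : ∀ p f → Unique (partitions p f)
  partitions-unique zero    f       = [] ∷ []
  partitions-unique (suc p) zero    = [] ∷ []
  partitions-unique (suc p) (suc f) = Unique.++⁺ (partitions-unique p (suc f))
    (onlyIf-unique (allowed? (suc p)) (Unique.map⁺ (λ { refl → refl }) (partitions-unique (suc p) f)))
        disjoint
    where
    disjoint : Disjoint (partitions p (suc f)) (onlyIf (allowed? (suc p))
        (map (suc p ∷_) (partitions (suc p) f)))
    disjoint (π∈₁ , π∈₂) with ∈-map⁻ (suc p ∷_) (proj₂ (∈-onlyIf (allowed? (suc p)) π∈₂))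
    ... | _ , _ , refl = ℕ.1+n≰n (proj₁ (proj₂ (All.head (proj₂ (partitions-sound p (suc f) π∈₁)))))

  -- (f , ν): the halves of the parts of π and the parts of λ or μ, both ascending.
  Configuration : Set
  Configuration = List ℕ × List ℕ

  weight : Configuration → ℕ
  weight (f , ν) = 2 * sum f + sum ν

  addSingle addPair : ℕ → Configuration → Configuration
  addSingle p (f , ν) = f , p ∷ ν
  addPair   a (f , ν) = a ∷ f , ν

  weight-addSingle : ∀ p c → weight (addSingle p c) ≡ p + weight c
  weight-addSingle p (f , ν) = eq p (sum f) (sum ν)
    where
    eq : ∀ p x y → 2 * x + (p + y) ≡ p + (2 * x + y)
    eq = solve-∀

  weight-addPair : ∀ a c → weight (addPair a c) ≡ a + a + weight c
  weight-addPair a (f , ν) = eq a (sum f) (sum ν)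
    where
    eq : ∀ a x y → 2 * (a + x) + y ≡ a + a + (2 * x + y)
    eq = solve-∀

  ⟦_⟧ : Bool → ℕ
  ⟦ false ⟧ = 0
  ⟦ true  ⟧ = 1

  -- δ = false gives the exclusion windows of B and δ = true those of C. All halves
  -- are ≥ a, the next window starts s above the next half, all singles are ≥ a + s,
  -- and a + s itself is not a single if z = true; k bounds the number of steps.
  configurations : Bool → ℕ → ℕ → ℕ → Bool → List Configuration
  configurations δ zero    a s z = [ [] , [] ]
  configurations δ (suc k) a s z =
    configurations δ k (suc a) s false ++
    ((if z then [] else map (addSingle (a + s)) (configurations δ k (suc a) s false)) ++
     map (addPair a) (configurations δ k (2 + a) (⟦ δ ⟧ + s) (not δ)))

  Outside : ℕ → ℕ → Set
  Outside c y = y < c ⊎ 3 + c ≤ y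

  Excludes : Bool → ℕ → Configuration → Set
  Excludes δ s ([] , ν)    = ⊤
  Excludes δ s (x ∷ f , ν) = All (Outside (x + s)) ν × Excludes δ (⟦ δ ⟧ + s) (f , ν)

  -- The bound b is kept apart from a because the singles start at a + s, or at a + s + 1 when the
  -- flag is set.
  record Admissible (δ : Bool) (s a b : ℕ) (c : Configuration) : Set where
    constructor admissible
    field
      halves≥     : All (a ≤_) (proj₁ c)
      halves-gap  : AllPairs (λ x y → 2 + x ≤ y) (proj₁ c)
      singles≥    : All (b ≤_) (proj₂ c)
      singles-asc : AllPairs _<_ (proj₂ c)
      excludes    : Excludes δ s c

  open Admissible

  All-≤-trans : ∀ {a b xs} → a ≤ b → All (b ≤_) xs → All (a ≤_) xs
  All-≤-trans a≤b = All.map (ℕ.≤-trans a≤b)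

  weaken : ∀ {δ s a a′ b b′ c} → a ≤ a′ → b ≤ b′ → Admissible δ s a′ b′ c → Admissible δ s a b c
  weaken a≤ b≤ (admissible h g s a e) = admissible (All-≤-trans a≤ h) g (All-≤-trans b≤ s) a e

  Excludes-addSingle : ∀ {δ s p} f {ν} → All (λ x → p < x + s) f →
                       Excludes δ s (f , ν) → Excludes δ s (f , p ∷ ν)
  Excludes-addSingle         []      _         _         = tt
  Excludes-addSingle {δ} {s} (x ∷ f) (p<x ∷ p<) (o , es) =
    (inj₁ p<x ∷ o) , Excludes-addSingle f (All.map (λ {y} p<y → ℕ.≤-trans p<y
        (ℕ.+-monoʳ-≤ y (ℕ.m≤n+m s ⟦ δ ⟧))) p<) es

  Excludes-removeSingle : ∀ {δ s p} f {ν} → Excludes δ s (f , p ∷ ν) → Excludes δ s (f , ν)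
  Excludes-removeSingle []      _            = tt
  Excludes-removeSingle (x ∷ f) ((_ ∷ o) , es) = o , Excludes-removeSingle f es

  ⟦⟧≤1 : ∀ z → ⟦ z ⟧ ≤ 1
  ⟦⟧≤1 false = z≤n
  ⟦⟧≤1 true  = ℕ.≤-refl

  -- The window of the half a ends at a + s + 2. For δ = false the next bound is this value and the
  -- flag removes it; for δ = true the larger shift starts just beyond it with the flag off.
  window-end : ∀ δ a s → ⟦ not δ ⟧ + (2 + a + (⟦ δ ⟧ + s)) ≡ 3 + (a + s)
  window-end false a s = refl
  window-end true  a s = ≡.cong (λ m → 2 + m) (ℕ.+-suc a s)

  skip-admissible : ∀ {δ s a c} z → Admissible δ s (suc a) (suc a + s) c →
      Admissible δ s a (⟦ z ⟧ + (a + s)) c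
  skip-admissible {s = s} {a} z = weaken (ℕ.n≤1+n a) (ℕ.+-monoˡ-≤ (a + s) (⟦⟧≤1 z))

  single-admissible : ∀ {δ s a c} → Admissible δ s (suc a) (suc a + s) c →
      Admissible δ s a (a + s) (addSingle (a + s) c)
  single-admissible {s = s} {a} {f , _} (admissible h g b asc ex) =
    admissible (All-≤-trans (ℕ.n≤1+n a) h) g (ℕ.≤-refl ∷ All-≤-trans (ℕ.n≤1+n (a + s)) b) (b ∷ asc)
      (Excludes-addSingle f (All.map (ℕ.+-monoˡ-≤ s) h) ex)

  pair-admissible : ∀ {δ s a c} z → Admissible δ (⟦ δ ⟧ + s) (2 + a) (3 + (a + s)) c →
      Admissible δ s a (⟦ z ⟧ + (a + s)) (addPair a c)
  pair-admissible {s = s} {a} z (admissible h g b asc ex) =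
    admissible (ℕ.≤-refl ∷ All-≤-trans (ℕ.m≤n+m a 2) h) (h ∷ g)
      (All-≤-trans (ℕ.+-monoˡ-≤ (a + s) (ℕ.≤-trans (⟦⟧≤1 z) (s≤s (z≤n {2})))) b) asc (All.map inj₂ b , ex)

  data Origin (δ : Bool) (k a s : ℕ) : Bool → Configuration → Set where
    skip   : ∀ {z c} → c ∈ configurations δ k (suc a) s false → Origin δ k a s z c
    single : ∀ {c} → c ∈ configurations δ k (suc a) s false → Origin δ k a s false (addSingle (a + s) c)
    pair   : ∀ {z c} → c ∈ configurations δ k (2 + a) (⟦ δ ⟧ + s) (not δ) → Origin δ k a s z (addPair a c)

  origin : ∀ δ k a s z {c} → c ∈ configurations δ (suc k) a s z → Origin δ k a s z c
  origin δ k a s z c∈ with ∈-++⁻ (configurations δ k (suc a) s false) c∈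
  ... | inj₁ c∈₁ = skip c∈₁
  origin δ k a s true c∈ | inj₂ c∈₂ with ∈-map⁻ (addPair a) c∈₂
  ... | _ , c∈₃ , refl = pair c∈₃
  origin δ k a s false c∈ | inj₂ c∈₂ with ∈-++⁻ (map (addSingle (a + s))
      (configurations δ k (suc a) s false)) c∈₂
  ... | inj₁ c∈₃ with ∈-map⁻ (addSingle (a + s)) c∈₃
  ...   | _ , c∈₄ , refl = single c∈₄
  origin δ k a s false c∈ | inj₂ c∈₂ | inj₂ c∈₃ with ∈-map⁻ (addPair a) c∈₃
  ...   | _ , c∈₄ , refl = pair c∈₄

  sound : ∀ δ k a s z {c} → c ∈ configurations δ k a s z → Admissible δ s a (⟦ z ⟧ + (a + s)) c
  sound δ zero    a s z (here refl) = admissible [] [] [] [] tt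
  sound δ (suc k) a s z c∈ with origin δ k a s z c∈
  ... | skip c∈₁   = skip-admissible z (sound δ k (suc a) s false c∈₁)
  ... | single c∈₁ = single-admissible (sound δ k (suc a) s false c∈₁)
  ... | pair {c = c} c∈₁ = pair-admissible z (≡.subst (λ b → Admissible δ (⟦ δ ⟧ + s) (2 + a) b c)
      (window-end δ a s)
                       (sound δ k (2 + a) (⟦ δ ⟧ + s) (not δ) c∈₁))

  skip-∈ : ∀ δ k a s z {c} → c ∈ configurations δ k (suc a) s false → c ∈ configurations δ (suc k) a s z
  skip-∈ δ k a s z = ∈-++⁺ˡ

  single-∈ : ∀ δ k a s {c} → c ∈ configurations δ k (suc a) s false →
      addSingle (a + s) c ∈ configurations δ (suc k) a s false
  single-∈ δ k a s c∈ = ∈-++⁺ʳ (configurations δ k (suc a) s false) (∈-++⁺ˡ (∈-map⁺ (addSingle (a + s)) c∈))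

  pair-∈ : ∀ δ k a s z {c} → c ∈ configurations δ k (2 + a) (⟦ δ ⟧ + s) (not δ) →
      addPair a c ∈ configurations δ (suc k) a s z
  pair-∈ δ k a s z c∈ = ∈-++⁺ʳ (configurations δ k (suc a) s false)
    (∈-++⁺ʳ (if z then [] else map (addSingle (a + s)) (configurations δ k (suc a) s false))
        (∈-map⁺ (addPair a) c∈))

  data Front (a : ℕ) : List ℕ → Set where
    starts : ∀ {xs} → All (a <_) xs → Front a (a ∷ xs)
    above  : ∀ {xs} → All (a <_) xs → Front a xs

  front : ∀ a {xs} → All (a ≤_) xs → AllPairs _<_ xs → Front a xs
  front a []        _         = above []
  front a {x ∷ xs} (a≤x ∷ _) (x< ∷ _) with x ℕ.≟ a
  ... | yes refl = starts x<
  ... | no x≢a   = above (a<x ∷ All.map (ℕ.<-trans a<x) x<)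
    where
    a<x : a < x
    a<x = ℕ.≤∧≢⇒< a≤x (λ a≡x → x≢a (≡.sym a≡x))

  beyond : ∀ {c y} → c ≤ y → Outside c y → 3 + c ≤ y
  beyond c≤y (inj₁ y<c) = ⊥-elim (ℕ.<⇒≱ y<c c≤y)
  beyond c≤y (inj₂ y≥)  = y≥

  fuel-step : ∀ k a {w} → w < suc k + a → w < k + suc a
  fuel-step k a {w} = ≡.subst (w <_) (≡.sym (ℕ.+-suc k a))

  -- The smallest entries determine the branch: a half a forces a pair, and otherwise a single a + s
  -- decides between the remaining two; the window keeps the first two cases apart. All entries are
  -- at least a, so by the bound on the weight nothing is left when the fuel is spent.
  complete : ∀ δ k a s z c → Admissible δ s a (⟦ z ⟧ + (a + s)) c → weight c < k + a →
      c ∈ configurations δ k a s z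
  complete δ zero a s z ([] , []) _ _ = here refl
  complete δ zero a s z ([] , y ∷ ν) (admissible _ _ (≤y ∷ _) _ _) w<a =
    ⊥-elim (ℕ.<⇒≱ w<a (ℕ.≤-trans (ℕ.≤-trans (ℕ.m≤m+n a s) (ℕ.m≤n+m (a + s) ⟦ z ⟧))
        (ℕ.≤-trans ≤y (ℕ.m≤m+n y (sum ν)))))
  complete δ zero a s z (x ∷ f , ν) (admissible (a≤x ∷ _) _ _ _ _) w<a =
    ⊥-elim (ℕ.<⇒≱ w<a (ℕ.≤-trans a≤x (ℕ.≤-trans (ℕ.m≤m+n x (sum f))
        (ℕ.≤-trans (ℕ.m≤n*m (x + sum f) 2) (ℕ.m≤m+n _ (sum ν))))))
  complete δ (suc k) a s z (f , ν) (admissible h g b asc ex) w< with front a h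
      (AllPairs.map (λ {x} → ℕ.≤-trans (s≤s (ℕ.n≤1+n x))) g)
  ... | starts {f′} a<f = pair-∈ δ k a s z (complete δ k (2 + a) (⟦ δ ⟧ + s) (not δ) (f′ , ν) rest
    (ℕ.≤-trans (fuel-step k a bound) (ℕ.+-monoʳ-≤ k (ℕ.n≤1+n (suc a)))))
    where
    rest : Admissible δ (⟦ δ ⟧ + s) (2 + a) (⟦ not δ ⟧ + (2 + a + (⟦ δ ⟧ + s))) (f′ , ν)
    rest = admissible (AllPairs.head g) (AllPairs.tail g)
      (≡.subst (λ b → All (b ≤_) ν) (≡.sym (window-end δ a s))
        (All.zipWith (λ (≤y , o) → beyond (ℕ.≤-trans (ℕ.m≤n+m (a + s) ⟦ z ⟧) ≤y) o) (b , proj₁ ex))) asc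
            (proj₂ ex)
    bound : weight (f′ , ν) < suc k + a
    bound = ℕ.≤-<-trans (ℕ.≤-trans (ℕ.m≤n+m _ (a + a))
        (ℕ.≤-reflexive (≡.sym (weight-addPair a (f′ , ν))))) w<
  complete δ (suc k) a s true (f , ν) (admissible h g b asc ex) w< | above a<f =
    skip-∈ δ k a s true (complete δ k (suc a) s false (f , ν) (admissible a<f g b asc ex)
        (fuel-step k a w<))
  complete δ (suc k) a s false (f , ν) (admissible h g b asc ex) w< | above a<f with front (a + s) b asc
  ... | above p<ν = skip-∈ δ k a s false
    (complete δ k (suc a) s false (f , ν) (admissible a<f g p<ν asc ex) (fuel-step k a w<))
  ... | starts {ν′} p<ν = single-∈ δ k a s
    (complete δ k (suc a) s false (f , ν′) (admissible a<f g p<ν (AllPairs.tail asc)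
        (Excludes-removeSingle f ex))
      (fuel-step k a (ℕ.≤-<-trans (ℕ.≤-trans (ℕ.m≤n+m _ (a + s))
          (ℕ.≤-reflexive (≡.sym (weight-addSingle (a + s) (f , ν′))))) w<)))

  addSingle-injective : ∀ {p c d} → addSingle p c ≡ addSingle p d → c ≡ d
  addSingle-injective refl = refl

  addPair-injective : ∀ {p c d} → addPair p c ≡ addPair p d → c ≡ d
  addPair-injective refl = refl

  configurations-unique : ∀ δ k a s z → Unique (configurations δ k a s z)
  configurations-unique δ zero    a s z = [] ∷ []
  configurations-unique δ (suc k) a s z =
    Unique.++⁺ (configurations-unique δ k (suc a) s false) (singles∪pairs z) (skip-disjoint z)
    where
    skips pairs : List Configuration
    skips = configurations δ k (suc a) s false
    pairs = map (addPair a) (configurations δ k (2 + a) (⟦ δ ⟧ + s) (not δ))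

    pairs-unique : Unique pairs
    pairs-unique = Unique.map⁺ addPair-injective (configurations-unique δ k (2 + a) (⟦ δ ⟧ + s) (not δ))

    pair∉ : ∀ {c} → addPair a c ∈ skips → ⊥
    pair∉ c∈ = ℕ.1+n≰n (All.head (halves≥ (sound δ k (suc a) s false c∈)))

    single∉ : ∀ {c} → addSingle (a + s) c ∈ skips → ⊥
    single∉ c∈ = ℕ.1+n≰n (All.head (singles≥ (sound δ k (suc a) s false c∈)))

    singles-pairs-disjoint : Disjoint (map (addSingle (a + s)) skips) pairs
    singles-pairs-disjoint (c∈₁ , c∈₂) with ∈-map⁻ (addSingle (a + s)) c∈₁ | ∈-map⁻ (addPair a) c∈₂
    ... | (_ , c∈₃ , refl) | (_ , _ , refl) = ℕ.1+n≰n (All.head (halves≥ (sound δ k (suc a) s false c∈₃)))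

    singles∪pairs : ∀ z → Unique ((if z then [] else map (addSingle (a + s)) skips) ++ pairs)
    singles∪pairs true  = pairs-unique
    singles∪pairs false = Unique.++⁺ (Unique.map⁺ addSingle-injective
        (configurations-unique δ k (suc a) s false))
                                     pairs-unique singles-pairs-disjoint

    skip-disjoint : ∀ z → Disjoint skips ((if z then [] else map (addSingle (a + s)) skips) ++ pairs)
    skip-disjoint z (c∈₁ , c∈₂) with ∈-++⁻ (if z then [] else map (addSingle (a + s)) skips) c∈₂
    skip-disjoint z     (c∈₁ , c∈₂) | inj₂ c∈₃ with ∈-map⁻ (addPair a) c∈₃
    ... | _ , _ , refl = pair∉ c∈₁
    skip-disjoint false (c∈₁ , c∈₂) | inj₁ c∈₃ with ∈-map⁻ (addSingle (a + s)) c∈₃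
    ... | _ , _ , refl = single∉ c∈₁

  -- From configurations to bipartitions and back

  decode : Configuration → List ℕ × List ℕ
  decode (f , ν) = reverse (map (2 *_) f) , reverse ν

  decode-injective : ∀ {c d} → decode c ≡ decode d → c ≡ d
  decode-injective eq = ≡.cong₂ _,_
    (map-injective (λ {x} {y} → ℕ.*-cancelˡ-≡ x y 2) (reverse-injective (proj₁ (,-injective eq))))
    (reverse-injective (proj₂ (,-injective eq)))

  All-reverse : ∀ {P : ℕ → Set} {xs} → All P xs → All P (reverse xs)
  All-reverse {xs = xs} = All-resp-↭ (↭-sym (↭-reverse xs))

  AllPairs-reverse : ∀ {R : ℕ → ℕ → Set} {xs} → AllPairs R xs → AllPairs (flip R) (reverse xs)
  AllPairs-reverse {xs = []}     []       = []
  AllPairs-reverse {R} {xs = x ∷ xs} (r ∷ rs) rewrite unfold-reverse x xs =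
    AllPairs.++⁺ (AllPairs-reverse rs) ([] ∷ []) (All.map (_∷ []) (All-reverse r))

  sum-reverse : ∀ xs → sum (reverse xs) ≡ sum xs
  sum-reverse xs = sum-↭ (↭-reverse xs)

  sum-double : ∀ xs → sum (map (2 *_) xs) ≡ 2 * sum xs
  sum-double []       = refl
  sum-double (x ∷ xs) = ≡.trans (≡.cong (λ m → 2 * x + m) (sum-double xs))
      (≡.sym (ℕ.*-distribˡ-+ 2 x (sum xs)))

  ∪-isPartition : ∀ {π μ} → IsPartition π → IsPartition μ → IsPartition (π ∪ μ)
  ∪-isPartition {π} {μ} (lπ , pπ) (lμ , pμ) =
      merge⁺ (decTotalOrder ℕ.≤-decTotalOrder) lπ lμ
    , All-resp-↭ (↭-sym (merge-↭ ℕ._≥?_ π μ)) (All.++⁺ pπ pμ)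

  gap-doubled : ∀ x → 2 * x + 4 ≡ 2 * (2 + x)
  gap-doubled = solve-∀

  Shape : ℕ → List ℕ × List ℕ → Set
  Shape n (π , μ) = IsBipartitionOf n (π , μ) × EvenParts π × DistinctParts μ

  decode-shape : ∀ {f ν} → All (2 ≤_) f → AllPairs (λ x y → 2 + x ≤ y) f → All (2 ≤_) ν → AllPairs _<_ ν →
                 Shape (weight (f , ν)) (decode (f , ν))
  decode-shape {f} {ν} f≥ f-gap ν≥ ν-asc =
      ( (Linked.map gap⇒≥ (AllPairs⇒Linked π-gap) , All.map (λ (_ , p>2) → ℕ.<-trans ℕ.z<s p>2) π-even)
      , μ-partition
      , ∪-isPartition (Linked.map gap⇒≥ (AllPairs⇒Linked π-gap) , All.map
          (λ (_ , p>2) → ℕ.<-trans ℕ.z<s p>2) π-even) μ-partition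
      , total)
    , (AllPairs.map gap⇒≢ π-gap , π-even , AllPairs⇒Linked π-gap)
    , (AllPairs.map (λ y<x x≡y → ℕ.<⇒≢ y<x (≡.sym x≡y)) μ-desc , All-reverse ν≥)
    where
    π μ : List ℕ
    π = reverse (map (2 *_) f)
    μ = reverse ν

    gap⇒≥ : ∀ {x y} → y + 4 ≤ x → x ≥ y
    gap⇒≥ = ℕ.m+n≤o⇒m≤o _

    gap⇒≢ : ∀ {x y} → y + 4 ≤ x → x ≢ y
    gap⇒≢ {x} y+4≤x refl = ℕ.<⇒≱ (ℕ.m<m+n x ℕ.z<s) y+4≤x

    π-gap : AllPairs (λ x y → y + 4 ≤ x) π
    π-gap = AllPairs-reverse (AllPairs.map⁺ (AllPairs.map
      (λ {x} {y} 2+x≤y → ≡.subst (_≤ 2 * y) (≡.sym (gap-doubled x)) (ℕ.*-monoʳ-≤ 2 2+x≤y)) f-gap))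

    π-even : All (λ p → 2 ∣ p × p > 2) π
    π-even = All-reverse (All.map⁺ (All.map (λ {x} 2≤x → m∣m*n x , ℕ.≤-trans (ℕ.n≤1+n 3)
        (ℕ.*-monoʳ-≤ 2 2≤x)) f≥))

    μ-desc : AllPairs _>_ μ
    μ-desc = AllPairs-reverse ν-asc

    μ-partition : IsPartition μ
    μ-partition = Linked.map ℕ.<⇒≤ (AllPairs⇒Linked μ-desc) , All.map (ℕ.<-trans ℕ.z<s) (All-reverse ν≥)

    total : sum (π ∪ μ) ≡ 2 * sum f + sum ν
    total = ≡.trans (sum-∪ π μ)
      (≡.cong₂ _+_ (≡.trans (sum-reverse (map (2 *_) f)) (sum-double f)) (sum-reverse ν))

  halve : ∀ {xs} → All (2 ∣_) xs → map (2 *_) (map (_/ 2) xs) ≡ xs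
  halve []         = refl
  halve (2∣x ∷ ps) = ≡.cong₂ _∷_ (m*[n/m]≡n 2∣x) (halve ps)

  encode : ∀ {n π μ} → Shape n (π , μ) →
           ∃[ c ] decode c ≡ (π , μ) × weight c ≡ n ×
             All (2 ≤_) (proj₁ c) × AllPairs (λ x y → 2 + x ≤ y) (proj₁ c) × All (2 ≤_) (proj₂ c) ×
                 AllPairs _<_ (proj₂ c)
  encode {n} {π} {μ} ((_ , (μ≥ , _) , _ , total) , (_ , even , gap) , (distinct , μ>1)) =
    (f , ν) , ≡.cong₂ _,_ π≡ (reverse-involutive μ) , weight≡ , f≥ , f-gap , All-reverse μ>1 ,
    AllPairs-reverse (AllPairs.zipWith (λ (x≥y , x≢y) → ℕ.≤∧≢⇒< x≥y (λ y≡x → x≢y (≡.sym y≡x)))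
        (Linked⇒AllPairs (flip ℕ.≤-trans) μ≥ , distinct))
    where
    f ν : List ℕ
    f = map (_/ 2) (reverse π)
    ν = reverse μ

    double-f : map (2 *_) f ≡ reverse π
    double-f = halve (All.map proj₁ (All-reverse even))

    π≡ : reverse (map (2 *_) f) ≡ π
    π≡ = ≡.trans (≡.cong reverse double-f) (reverse-involutive π)

    f≥ : All (2 ≤_) f
    f≥ = All.map (λ {x} → ℕ.*-cancelˡ-< 2 1 x)
      (All.map⁻ (≡.subst (All (2 <_)) (≡.sym double-f) (All.map proj₂ (All-reverse even))))

    gap-trans : ∀ {x y z} → y + 4 ≤ x → z + 4 ≤ y → z + 4 ≤ x
    gap-trans y+4≤x z+4≤y = ℕ.≤-trans z+4≤y (ℕ.m+n≤o⇒m≤o _ y+4≤x)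

    f-gap : AllPairs (λ x y → 2 + x ≤ y) f
    f-gap = AllPairs.map (λ {x} {y} g → ℕ.*-cancelˡ-≤ 2 (≡.subst (_≤ 2 * y) (gap-doubled x) g))
      (AllPairs.map⁻ (≡.subst (AllPairs (λ x y → x + 4 ≤ y)) (≡.sym double-f)
        (AllPairs-reverse (Linked⇒AllPairs gap-trans gap))))

    weight≡ : 2 * sum f + sum ν ≡ n
    weight≡ = begin
      2 * sum f + sum ν           ≡⟨ ≡.cong (_+ sum ν) (sum-double f) ⟨
      sum (map (2 *_) f) + sum ν  ≡⟨ ≡.cong₂ _+_ (≡.trans (≡.cong sum double-f) (sum-reverse π))
          (sum-reverse μ) ⟩
      sum π + sum μ               ≡⟨ sum-∪ π μ ⟨
      sum (π ∪ μ)                 ≡⟨ total ⟩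
      n                           ∎
      where open ≡.≡-Reasoning

  WindowAvoids : List ℕ → ℕ → Set
  WindowAvoids μ c = (c ∉ μ) × (c + 1 ∉ μ) × (c + 2 ∉ μ)

  outside⇒avoids : ∀ {c ν} → All (Outside c) ν → WindowAvoids (reverse ν) c
  outside⇒avoids {c} {ν} out =
      (λ c∈ → no-outside (ℕ.≤-refl) (ℕ.m<n⇒m<1+n (ℕ.m<n⇒m<1+n (ℕ.n<1+n c))) (at c∈))
    , (λ c∈ → no-outside (ℕ.m≤m+n c 1) (ℕ.m≤n⇒m≤1+n (ℕ.≤-reflexive (≡.cong suc (ℕ.+-comm c 1)))) (at c∈))
    , (λ c∈ → no-outside (ℕ.m≤m+n c 2) (ℕ.≤-reflexive (≡.cong suc (ℕ.+-comm c 2))) (at c∈))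
    where
    at : ∀ {y} → y ∈ reverse ν → Outside c y
    at y∈ = All.lookup out (∈-resp-↭ (↭-reverse ν) y∈)
    no-outside : ∀ {y} → c ≤ y → y < 3 + c → ¬ Outside c y
    no-outside c≤y y<  (inj₁ y<c) = ℕ.<⇒≱ y<c c≤y
    no-outside c≤y y<  (inj₂ y≥)  = ℕ.<⇒≱ y< y≥

  avoids⇒outside : ∀ {c ν} → WindowAvoids (reverse ν) c → All (Outside c) ν
  avoids⇒outside {c} {ν} (c∉ , c+1∉ , c+2∉) = All.tabulate go
    where
    in-reverse : ∀ {y} → y ∈ ν → y ∈ reverse ν
    in-reverse = ∈-resp-↭ (↭-sym (↭-reverse ν))
    go : ∀ {y} → y ∈ ν → Outside c y
    go {y} y∈ with y ℕ.<? c
    ... | yes y<c = inj₁ y<c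
    ... | no y≮c with ℕ.m≤n⇒∃[o]m+o≡n (ℕ.≮⇒≥ y≮c)
    ...   | 0 , eq = ⊥-elim (c∉ (≡.subst (_∈ reverse ν) (≡.trans (≡.sym eq) (ℕ.+-identityʳ c))
        (in-reverse y∈)))
    ...   | 1 , eq = ⊥-elim (c+1∉ (≡.subst (_∈ reverse ν) (≡.sym eq) (in-reverse y∈)))
    ...   | 2 , eq = ⊥-elim (c+2∉ (≡.subst (_∈ reverse ν) (≡.sym eq) (in-reverse y∈)))
    ...   | suc (suc (suc o)) , eq = inj₂ (≡.subst (3 + c ≤_) eq
              (ℕ.≤-trans (ℕ.≤-reflexive (ℕ.+-comm 3 c)) (ℕ.+-monoʳ-≤ c (s≤s (s≤s (s≤s z≤n))))))

  -- Indexed by position, as the exclusion conditions of B and C are; s accounts for the halves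
  -- already removed from the front of the list.
  Windows : Bool → ℕ → List ℕ → List ℕ → Set
  Windows δ s μ xs = ∀ (i : Fin (length xs)) → WindowAvoids μ (lookup xs i / 2 + (toℕ i * ⟦ δ ⟧ + s))

  half : ∀ x → 2 * x / 2 ≡ x
  half x = ≡.trans (≡.cong (_/ 2) (ℕ.*-comm 2 x)) (m*n/n≡m x 2)

  shift-start : ∀ i d s → i * d + (d + s) ≡ d + i * d + s
  shift-start = solve-∀

  excludes⇒windows : ∀ δ s f {ν} → Excludes δ s (f , ν) → Windows δ s (reverse ν) (map (2 *_) f)
  excludes⇒windows δ s (x ∷ f) {ν} (out , ex) zero =
    ≡.subst (λ y → WindowAvoids (reverse ν) (y + s)) (≡.sym (half x)) (outside⇒avoids out)
  excludes⇒windows δ s (x ∷ f) {ν} (out , ex) (suc i) =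
    ≡.subst (λ t → WindowAvoids (reverse ν) (lookup (map (2 *_) f) i / 2 + t)) (shift-start (toℕ i) ⟦ δ ⟧ s)
      (excludes⇒windows δ (⟦ δ ⟧ + s) f ex i)

  windows⇒excludes : ∀ δ s f {ν} → Windows δ s (reverse ν) (map (2 *_) f) → Excludes δ s (f , ν)
  windows⇒excludes δ s []      w = tt
  windows⇒excludes δ s (x ∷ f) {ν} w =
      avoids⇒outside (≡.subst (λ y → WindowAvoids (reverse ν) (y + s)) (half x) (w zero))
    , windows⇒excludes δ (⟦ δ ⟧ + s) f λ i →
        ≡.subst (λ t → WindowAvoids (reverse ν) (lookup (map (2 *_) f) i / 2 + t))
            (≡.sym (shift-start (toℕ i) ⟦ δ ⟧ s)) (w (suc i))

  -- The common form of InB (δ = false) and InC (δ = true).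
  InD : Bool → ℕ → List ℕ × List ℕ → Set
  InD δ n (π , μ) = Shape n (π , μ) × Windows δ 0 μ (reverse π)

  windows-reverse : ∀ {δ μ} xs → Windows δ 0 μ (reverse (reverse xs)) ≡ Windows δ 0 μ xs
  windows-reverse {δ} {μ} xs = ≡.cong (Windows δ 0 μ) (reverse-involutive xs)

  decode-InD : ∀ {δ c} → Admissible δ 0 2 2 c → InD δ (weight c) (decode c)
  decode-InD {δ} {f , ν} (admissible h g b asc ex) =
    decode-shape h g b asc , ≡.subst (λ t → t) (≡.sym (windows-reverse {δ} (map (2 *_) f)))
        (excludes⇒windows δ 0 f ex)

  encode-InD : ∀ {δ n b} → InD δ n b → ∃[ c ] decode c ≡ b × weight c ≡ n × Admissible δ 0 2 2 c
  encode-InD {δ} (shape , w) with encode shape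
  ... | (f , ν) , refl , eq , h , g , b , asc =
    (f , ν) , refl , eq , admissible h g b asc
      (windows⇒excludes δ 0 f (≡.subst (λ t → t) (windows-reverse {δ} (map (2 *_) f)) w))

  InB⇔InD : ∀ n b → InB n b ⇔ InD false n b
  InB⇔InD n (π , μ) = mk⇔
    (λ (x , y , z , ex) → (x , y , z) , λ i → ≡.subst (WindowAvoids μ) (eq i) (ex i))
    (λ ((x , y , z) , w) → x , y , z , λ i → ≡.subst (WindowAvoids μ) (≡.sym (eq i)) (w i))
    where
    eq : ∀ i → e π i / 2 ≡ e π i / 2 + (toℕ i * 0 + 0)
    eq i = ≡.sym (≡.trans (≡.cong (λ m → e π i / 2 + m) (≡.trans (ℕ.+-identityʳ _) (ℕ.*-zeroʳ (toℕ i))))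
        (ℕ.+-identityʳ _))

  InC⇔InD : ∀ n b → InC n b ⇔ InD true n b
  InC⇔InD n (π , μ) = mk⇔
    (λ (x , y , z , ex) → (x , y , z) , λ i → ≡.subst (λ t → t) (eq (e π i / 2) (toℕ i)) (ex i))
    (λ ((x , y , z) , w) → x , y , z , λ i → ≡.subst (λ t → t) (≡.sym (eq (e π i / 2) (toℕ i))) (w i))
    where
    -- Positions i count from 0 and j = i + 1, so the truncated j - 1 is i and the window starts at
    -- h + i.
    eq : ∀ h i → ((h + suc i ∸ 1 ∉ μ) × (h + suc i ∉ μ) × (h + suc i + 1 ∉ μ)) ≡ WindowAvoids μ
        (h + (i * 1 + 0))
    eq h i rewrite ℕ.+-suc h i | ℕ.*-identityʳ i | ℕ.+-identityʳ i | ℕ.+-comm (h + i) 2 | ℕ.+-comm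
        (h + i) 1 = refl

  -- Duplicate-free lists with the same members are permutations of each other. This replaces the
  -- search through all compositions by lists that follow the recurrences.
  size≡length : {X : Set} {P : X → Set} (enum : Enumeration P) {xs : List X} → Unique xs →
                (∀ {x} → x ∈ xs ⇔ P x) → Enumeration.size enum ≡ length xs
  size≡length enum {xs} uniq xs⇔P = ↭-length (∼bag⇒↭ (unique∧set⇒bag (Enumeration.unique enum) uniq
    λ {x} → ⇔-trans (Enumeration.member enum) (⇔-sym xs⇔P)))

  count : {X : Set} → (X → ℕ) → ℕ → List X → ℕ
  count w n xs = length (filter (λ x → w x ℕ.≟ n) xs)

  A≡count : ∀ n p f → n ≤ p → n ≤ f → A n ≡ count sum n (partitions p f)
  A≡count n p f n≤p n≤f = size≡length (enumerationA n) (Unique.filter⁺ _ (partitions-unique p f))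
      (mk⇔ to from)
    where
    to : ∀ {π} → π ∈ filter (λ x → sum x ℕ.≟ n) (partitions p f) → InA n π
    to π∈ with ∈-filter⁻ (λ x → sum x ℕ.≟ n) {xs = partitions p f} π∈
    ... | π∈₁ , sum≡ with partitions-sound p f π∈₁
    ...   | d , parts = ((AllPairs⇒Linked d , All.map proj₁ parts) , sum≡) , All.map
        (λ (_ , _ , al) → al) parts

    parts≤sum : ∀ xs → All (_≤ sum xs) xs
    parts≤sum []       = []
    parts≤sum (x ∷ xs) = ℕ.m≤m+n x (sum xs) ∷ All.map (λ y≤ → ℕ.≤-trans y≤ (ℕ.m≤n+m (sum xs) x))
        (parts≤sum xs)

    from : ∀ {π} → InA n π → π ∈ filter (λ x → sum x ℕ.≟ n) (partitions p f)
    from {π} (((desc , pos) , refl) , al) = ∈-filter⁺ (λ x → sum x ℕ.≟ n)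
      (partitions-complete p f (Linked⇒AllPairs (flip ℕ.≤-trans) desc)
        (All.zipWith (λ (y> , y≤ , a) → y> , ℕ.≤-trans y≤ n≤p , a) (pos , All.zip (parts≤sum π , al)))
            n≤f) refl

  D≡count : ∀ δ n k {P : List ℕ × List ℕ → Set} (enum : Enumeration P) → (∀ b → P b ⇔ InD δ n b) →
      n < k + 2 →
            Enumeration.size enum ≡ count weight n (configurations δ k 2 0 false)
  D≡count δ n k enum P⇔ n< = ≡.trans
    (size≡length enum (Unique.map⁺ decode-injective
        (Unique.filter⁺ _ (configurations-unique δ k 2 0 false)))
      λ {b} → ⇔-trans (mk⇔ to from) (⇔-sym (P⇔ b)))
    (length-map decode (filter _ (configurations δ k 2 0 false)))
    where
    cs : List Configuration
    cs = filter (λ c → weight c ℕ.≟ n) (configurations δ k 2 0 false)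
    to : ∀ {b} → b ∈ map decode cs → InD δ n b
    to b∈ with ∈-map⁻ decode b∈
    ... | c , c∈ , refl with ∈-filter⁻ (λ c → weight c ℕ.≟ n) {xs = configurations δ k 2 0 false} c∈
    ...   | c∈₁ , refl = decode-InD (sound δ k 2 0 false c∈₁)
    from : ∀ {b} → InD δ n b → b ∈ map decode cs
    from ind with encode-InD {δ} ind
    ... | c , refl , refl , adm = ∈-map⁺ decode (∈-filter⁺ (λ c → weight c ℕ.≟ n)
        (complete δ k 2 0 false c adm n<) refl)

open Combinatorics

-- Generating functions

module GeneratingFunctions {c ℓ : Level} (R : CommutativeRing c ℓ) where
  open CommutativeRing R
  open IntegerCoefficients R
  open SumsAndProducts R
  open QSeries R
  open AndrewsGordon R
  open JacobiTripleProduct R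
  open import Algebra.Properties.Semiring.Exp semiring using (_^_; ^-homo-*; ^-congʳ; ^-congˡ; ^-assocʳ)
  open import Relation.Binary.Reasoning.Setoid setoid

  module _ (q : Carrier) where
    gf : {X : Set} → (X → ℕ) → List X → Carrier
    gf w []       = 0#
    gf w (x ∷ xs) = q ^ w x + gf w xs

    gf-++ : {X : Set} (w : X → ℕ) (xs ys : List X) → gf w (xs ++ ys) ≈ gf w xs + gf w ys
    gf-++ w []       ys = sym (+-identityˡ _)
    gf-++ w (x ∷ xs) ys = trans (+-congˡ (gf-++ w xs ys)) (sym (+-assoc _ _ _))

    gf-map : {X : Set} (w : X → ℕ) (f : X → X) (k : ℕ) → (∀ x → w (f x) ≡ k ℕ.+ w x) →
             ∀ xs → gf w (map f xs) ≈ q ^ k * gf w xs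
    gf-map w f k eq []       = sym (zeroʳ _)
    gf-map w f k eq (x ∷ xs) = begin
      q ^ w (f x) + gf w (map f xs)      ≈⟨ +-cong (trans (^-congʳ q (eq x)) (^-homo-* q k (w x)))
          (gf-map w f k eq xs) ⟩
      q ^ k * q ^ w x + q ^ k * gf w xs  ≈⟨ distribˡ _ _ _ ⟨
      q ^ k * (q ^ w x + gf w xs)        ∎

    -- The product for A

    gfA : ℕ → ℕ → Carrier
    gfA p f = gf sum (partitions p f)

    gfA-allowed : ∀ p f → Allowed (suc p) → gfA (suc p) (suc f) ≈ gfA p (suc f) + q ^ suc p * gfA (suc p) f
    gfA-allowed p f al = trans (gf-++ sum (partitions p (suc f)) _) (+-congˡ (trans
      (reflexive (≡.cong (gf sum) (onlyIf-yes (allowed? (suc p)) al)))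
      (gf-map sum (suc p ∷_) (suc p) (λ _ → ≡.refl) (partitions (suc p) f))))

    gfA-forbidden : ∀ p f → ¬ Allowed (suc p) → gfA (suc p) (suc f) ≈ gfA p (suc f)
    gfA-forbidden p f ¬al = trans (gf-++ sum (partitions p (suc f)) _) (trans (+-congˡ
      (reflexive (≡.cong (gf sum) (onlyIf-no (allowed? (suc p)) ¬al)))) (+-identityʳ _))

    gfA-zero : ∀ p → gfA p 0 ≈ 1#
    gfA-zero zero    = +-identityʳ _
    gfA-zero (suc p) = +-identityʳ _

    module _ {M : ℕ} (q-nil : Nilpotent q M) where
      -- A partition with more than f positive parts has weight above f, so it disappears after
      -- multiplication by q^g. In the induction q^g accumulates the parts already split off.
      gfA-stable : ∀ p f g → M ≤ g ℕ.+ f → q ^ g * gfA p (suc f) ≈ q ^ g * gfA p f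
      gfA-stable zero    f       g M≤ = refl
      gfA-stable (suc p) zero    g M≤ = trans (*-congʳ z)
          (trans (zeroˡ _) (sym (trans (*-congʳ z) (zeroˡ _))))
        where
        z : q ^ g ≈ 0#
        z = q-nil g (≡.subst (M ≤_) (ℕ.+-identityʳ g) M≤)
      gfA-stable (suc p) (suc f) g M≤ with toSum (allowed? (suc p))
      ... | inj₁ al = begin
        q ^ g * gfA (suc p) (2 ℕ.+ f)                         ≈⟨ *-congˡ (gfA-allowed p (suc f) al) ⟩
        q ^ g * (gfA p (2 ℕ.+ f) + q ^ suc p * gfA (suc p) (suc f)) ≈⟨ rearrange _ _ _ _ ⟩
        q ^ g * gfA p (2 ℕ.+ f) + q ^ suc p * q ^ g * gfA (suc p) (suc f)
          ≈⟨ +-cong (gfA-stable p (suc f) g M≤) (trans (*-congʳ (sym (^-homo-* q (suc p) g)))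
               (trans (gfA-stable (suc p) f (suc p ℕ.+ g) M≤′) (*-congʳ (^-homo-* q (suc p) g)))) ⟩
        q ^ g * gfA p (suc f) + q ^ suc p * q ^ g * gfA (suc p) f   ≈⟨ rearrange _ _ _ _ ⟨
        q ^ g * (gfA p (suc f) + q ^ suc p * gfA (suc p) f)         ≈⟨ *-congˡ (gfA-allowed p f al) ⟨
        q ^ g * gfA (suc p) (suc f)                           ∎
        where
        rearrange : ∀ x a y b → x * (a + y * b) ≈ x * a + y * x * b
        rearrange = solve 4 (λ x a y b → x :* (a :+ y :* b) := x :* a :+ y :* x :* b) refl
        M≤′ : M ≤ suc p ℕ.+ g ℕ.+ f
        M≤′ = ℕ.≤-trans (≡.subst (M ≤_) (ℕ.+-suc g f) M≤) (s≤s (ℕ.+-monoˡ-≤ f (ℕ.m≤n+m g p)))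
      ... | inj₂ ¬al = trans (*-congˡ (gfA-forbidden p (suc f) ¬al))
        (trans (gfA-stable p (suc f) g M≤) (*-congˡ (sym (gfA-forbidden p f ¬al))))

      a : ℕ → Carrier
      a p = gfA p (suc M)

      -- Splitting off a part costs one unit of the bound on the number of parts; `gfA-stable`
      -- restores it, which yields the factor 1/(1 - q^(p+1)).
      a-allowed : ∀ p → Allowed (suc p) → (1# - q ^ suc p) * a (suc p) ≈ a p
      a-allowed p al = begin
        (1# - z) * a (suc p)               ≈⟨ solve 2 (λ z x → (con (+ 1) :- z) :* x := x :- z :* x)
            refl z _ ⟩
        a (suc p) - z * a (suc p)          ≈⟨ +-cong (gfA-allowed p M al) (-‿cong (*-congˡ stable)) ⟩
        a p + z * gfA (suc p) M - z * gfA (suc p) M  ≈⟨ solve 2 (λ x y → x :+ y :- y := x) refl _ _ ⟩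
        a p                                ∎
        where
        z : Carrier
        z = q ^ suc p
        stable : a (suc p) ≈ gfA (suc p) M
        stable = trans (sym (*-identityˡ _)) (trans (gfA-stable (suc p) M 0 ℕ.≤-refl) (*-identityˡ _))

      ϕ : ℕ → ℕ → Carrier
      ϕ r i = 1# - q ^ (r ℕ.+ i ℕ.* 7)

      block : ∀ i → (ϕ 2 i * ϕ 3 i * ϕ 4 i * ϕ 5 i) * a (7 ℕ.+ i ℕ.* 7) ≈ a (i ℕ.* 7)
      block i = begin
        (ϕ 2 i * ϕ 3 i * ϕ 4 i * ϕ 5 i) * a (7 ℕ.+ i ℕ.* 7)
          ≈⟨ *-congˡ (trans (gfA-forbidden (6 ℕ.+ i ℕ.* 7) M (¬allowed₇ i))
              (gfA-forbidden (5 ℕ.+ i ℕ.* 7) M (¬allowed₆ i))) ⟩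
        (ϕ 2 i * ϕ 3 i * ϕ 4 i * ϕ 5 i) * a (5 ℕ.+ i ℕ.* 7)
          ≈⟨ solve 5 (λ b c d e x → (b :* c :* d :* e) :* x := b :* (c :* (d :* (e :* x)))) refl _ _ _ _ _ ⟩
        ϕ 2 i * (ϕ 3 i * (ϕ 4 i * (ϕ 5 i * a (5 ℕ.+ i ℕ.* 7))))
          ≈⟨ *-congˡ (*-congˡ (*-congˡ (a-allowed (4 ℕ.+ i ℕ.* 7) (allowed₅ i)))) ⟩
        ϕ 2 i * (ϕ 3 i * (ϕ 4 i * a (4 ℕ.+ i ℕ.* 7)))
            ≈⟨ *-congˡ (*-congˡ (a-allowed (3 ℕ.+ i ℕ.* 7) (allowed₄ i))) ⟩
        ϕ 2 i * (ϕ 3 i * a (3 ℕ.+ i ℕ.* 7))           ≈⟨ *-congˡ (a-allowed (2 ℕ.+ i ℕ.* 7) (allowed₃ i)) ⟩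
        ϕ 2 i * a (2 ℕ.+ i ℕ.* 7)                     ≈⟨ a-allowed (1 ℕ.+ i ℕ.* 7) (allowed₂ i) ⟩
        a (1 ℕ.+ i ℕ.* 7)                             ≈⟨ gfA-forbidden (i ℕ.* 7) M (¬allowed₁ i) ⟩
        a (i ℕ.* 7)                                   ∎

      -- Of every seven consecutive factors of (q;q)_(7n), `block` consumes those with residues 2 to
      -- 5.
      F*a : ∀ n → F q M (n ℕ.* 7) * a (n ℕ.* 7) ≈ Π (λ i → ϕ 1 i * ϕ 6 i * ϕ 7 i) n
      F*a zero    = trans (*-identityˡ _) (+-identityʳ _)
      F*a (suc n) = begin
        F q M (n ℕ.* 7) * ϕ 1 n * ϕ 2 n * ϕ 3 n * ϕ 4 n * ϕ 5 n * ϕ 6 n * ϕ 7 n * a (7 ℕ.+ n ℕ.* 7)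
          ≈⟨ solve 9 (λ p b c d e f g h x → p :* b :* c :* d :* e :* f :* g :* h :* x :=
               p :* ((c :* d :* e :* f) :* x) :* (b :* g :* h)) refl _ _ _ _ _ _ _ _ _ ⟩
        F q M (n ℕ.* 7) * ((ϕ 2 n * ϕ 3 n * ϕ 4 n * ϕ 5 n) * a (7 ℕ.+ n ℕ.* 7)) * (ϕ 1 n * ϕ 6 n * ϕ 7 n)
          ≈⟨ *-congʳ (trans (*-congˡ (block n)) (F*a n)) ⟩
        Π (λ i → ϕ 1 i * ϕ 6 i * ϕ 7 i) (suc n) ∎

      nil-*7 : Nilpotent q (M ℕ.* 7)
      nil-*7 n M*7≤n = q-nil n (ℕ.≤-trans (ℕ.m≤m*n M 7) M*7≤n)

      module _ (0<M : 0 < M) where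
        0<M*7 : 0 < M ℕ.* 7
        0<M*7 = ℕ.≤-trans 0<M (ℕ.m≤m*n M 7)

        ϕ≈ : ∀ r i → 1# - q ^ r * (q ^ 7) ^ i ≈ ϕ r i
        ϕ≈ r i = +-congˡ (-‿cong (trans (*-congˡ (trans (^-assocʳ q 7 i) (^-congʳ q (ℕ.*-comm 7 i))))
            (sym (^-homo-* q r (i ℕ.* 7)))))

        -- Multiplied by (q;q)_∞ both sides become the same triple product. Here (q;q)_∞ is taken
        -- with 7M factors, so that it splits into complete blocks, and `W` is therefore used with
        -- the larger bound of `nil-*7`.
        a≈W : a (M ℕ.* 7) ≈ Recurrences.Configurations.W R q nil-*7 2
        a≈W = E-cancel (M ℕ.* 7) nil-*7 (s≤s z≤n) (begin
          E (M ℕ.* 7) q 1 * a (M ℕ.* 7)          ≈⟨ *-congʳ (E₁≈F q (M ℕ.* 7) nil-*7) ⟩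
          F q M (M ℕ.* 7) * a (M ℕ.* 7)          ≈⟨ F*a M ⟩
          Π (λ i → ϕ 1 i * ϕ 6 i * ϕ 7 i) M
            ≈⟨ Π-cong (λ i → *-cong (*-cong (trans (+-congˡ (-‿cong (*-congʳ (sym (*-identityʳ q)))))
                (ϕ≈ 1 i)) (ϕ≈ 6 i)) (ϕ≈ 7 i)) M ⟨
          _                                      ≈⟨ θ-product q-nil (ℕ.m≤m*n M 7) 0<M*7 ⟨
          Σ (Theta.θ q) (M ℕ.* 7)                ≈⟨ W₂≈θ q (M ℕ.* 7) nil-*7 0<M*7 ⟨
          E (M ℕ.* 7) q 1 * Recurrences.Configurations.W R q nil-*7 2 ∎)

-- The recurrences for the configurations of B and C

module ConfigurationSeries {c ℓ : Level} (R : CommutativeRing c ℓ) where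
  open CommutativeRing R renaming (refl to ≈-refl)
  open IntegerCoefficients R
  open QSeries R using (Nilpotent)
  open Recurrences R
  open GeneratingFunctions R
  open import Algebra.Properties.Semiring.Exp semiring using (_^_; ^-homo-*)
  open import Relation.Binary.Reasoning.Setoid setoid

  module _ (q : Carrier) where
    open Configurations q

    gfD : Bool → ℕ → ℕ → ℕ → Bool → Carrier
    gfD δ k a s z = gf q weight (configurations δ k a s z)

    gfD-zero : ∀ δ a s z → gfD δ 0 a s z ≈ 1#
    gfD-zero δ a s z = +-identityʳ 1#

    gf-addPair : ∀ a cs → gf q weight (map (addPair a) cs) ≈ q ^ a * q ^ a * gf q weight cs
    gf-addPair a cs = trans (gf-map q weight (addPair a) (a ℕ.+ a) (weight-addPair a) cs)
        (*-congʳ (^-homo-* q a a))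

    gf-addSingle : ∀ a s cs → gf q weight (map (addSingle (a ℕ.+ s)) cs) ≈ q ^ a * q ^ s * gf q weight cs
    gf-addSingle a s cs = trans (gf-map q weight (addSingle (a ℕ.+ s)) (a ℕ.+ s)
        (weight-addSingle (a ℕ.+ s)) cs) (*-congʳ (^-homo-* q a s))

    gfD-step : ∀ δ k a s → gfD δ (suc k) a s false ≈
      gfD δ k (suc a) s false + (q ^ a * q ^ s * gfD δ k (suc a) s false + q ^ a * q ^ a * gfD δ k
          (2 ℕ.+ a) (⟦ δ ⟧ ℕ.+ s) (not δ))
    gfD-step δ k a s = trans (gf-++ q weight (configurations δ k (suc a) s false) _)
      (+-congˡ (trans (gf-++ q weight (map (addSingle (a ℕ.+ s)) (configurations δ k (suc a) s false)) _)
        (+-cong (gf-addSingle a s (configurations δ k (suc a) s false))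
            (gf-addPair a (configurations δ k (2 ℕ.+ a) (⟦ δ ⟧ ℕ.+ s) (not δ))))))

    gfD-noSingle : ∀ δ k a s → gfD δ (suc k) a s true ≈
      gfD δ k (suc a) s false + q ^ a * q ^ a * gfD δ k (2 ℕ.+ a) (⟦ δ ⟧ ℕ.+ s) (not δ)
    gfD-noSingle δ k a s = trans (gf-++ q weight (configurations δ k (suc a) s false) _)
      (+-congˡ (gf-addPair a (configurations δ k (2 ℕ.+ a) (⟦ δ ⟧ ℕ.+ s) (not δ))))

    gfC≈V : ∀ k a s → gfD true k a s false ≈ V k a s
    gfC≈V zero    a s = gfD-zero true a s false
    gfC≈V (suc k) a s = trans (gfD-step true k a s)
      (+-cong (gfC≈V k (suc a) s) (+-cong (*-congˡ (gfC≈V k (suc a) s))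
          (*-congˡ (gfC≈V k (2 ℕ.+ a) (suc s)))))

    module _ {M : ℕ} (q-nil : Nilpotent q M) where
      -- The shift s stays 0 for B, and a set flag corresponds to σ = 1. With the flag set, the
      -- recursion of B is the second reading `V-noSingle`, which leads back to σ ≤ 1 although the
      -- definition of `V` would go on to σ = 2.
      gfB≈V : ∀ k a z → M < k ℕ.+ a → gfD false k a 0 z ≈ V k a ⟦ z ⟧
      gfB≈V zero    a z     _  = gfD-zero false a 0 z
      gfB≈V (suc k) a false M< = trans (gfD-step false k a 0)
        (+-cong (gfB≈V k (suc a) false (fuel-step k a M<))
            (+-cong (*-congˡ (gfB≈V k (suc a) false (fuel-step k a M<)))
          (*-congˡ (gfB≈V k (2 ℕ.+ a) true (ℕ.≤-trans (fuel-step k a M<)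
              (ℕ.+-monoʳ-≤ k (ℕ.n≤1+n (suc a))))))))
      gfB≈V (suc k) a true  M< = trans (gfD-noSingle false k a 0) (trans
        (+-cong (gfB≈V k (suc a) false (fuel-step k a M<))
          (*-congˡ (gfB≈V k (2 ℕ.+ a) true (ℕ.≤-trans (fuel-step k a M<)
              (ℕ.+-monoʳ-≤ k (ℕ.n≤1+n (suc a)))))))
        (sym (V-noSingle q-nil k a 0 (ℕ.s≤s⁻¹ M<))))

-- Integer power series modulo q^(N+1)

module TruncatedPowerSeries (N : ℕ) where
  open import Relation.Binary.PropositionalEquality using (refl)
  open import Data.Integer.Tactic.RingSolver using (solve-∀)

  Series : Set
  Series = ℕ → ℤ

  infix 4 _≈_
  -- Truncation sits in the equality alone. The operations are those of full power series, and
  -- `mul-cong` makes them compatible, as a coefficient of a product involves no later coefficients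
  -- of its factors.
  _≈_ : Series → Series → Set
  f ≈ g = ∀ n → n ≤ N → f n ≡ g n

  one : Series
  one zero    = 1ℤ
  one (suc n) = 0ℤ

  -- The Cauchy product through (f 0 + q f') g = f 0 g + q (f' g), which needs no indexed sums.
  mul : Series → Series → Series
  mul f g zero    = f 0 ℤ.* g 0
  mul f g (suc n) = f 0 ℤ.* g (suc n) ℤ.+ mul (f ∘ suc) g n

  mul-cong : ∀ {f f′ g g′} n → (∀ k → k ≤ n → f k ≡ f′ k) → (∀ k → k ≤ n → g k ≡ g′ k) →
      mul f g n ≡ mul f′ g′ n
  mul-cong zero    f≡ g≡ = ≡.cong₂ ℤ._*_ (f≡ 0 z≤n) (g≡ 0 z≤n)
  mul-cong (suc n) f≡ g≡ = ≡.cong₂ ℤ._+_ (≡.cong₂ ℤ._*_ (f≡ 0 z≤n) (g≡ (suc n) ℕ.≤-refl))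
    (mul-cong n (λ k k≤n → f≡ (suc k) (s≤s k≤n)) (λ k k≤n → g≡ k (ℕ.m≤n⇒m≤1+n k≤n)))

  -- The recursion of `mul` taken on the right factor instead; commutativity follows from it by
  -- induction.
  mul-sucʳ : ∀ f g n → mul f g (suc n) ≡ g 0 ℤ.* f (suc n) ℤ.+ mul f (g ∘ suc) n
  mul-sucʳ f g zero    = eq (f 0) (f 1) (g 0) (g 1)
    where
    eq : ∀ a b c d → a ℤ.* d ℤ.+ b ℤ.* c ≡ c ℤ.* b ℤ.+ a ℤ.* d
    eq = solve-∀
  mul-sucʳ f g (suc n) = ≡.trans (≡.cong (λ x → f 0 ℤ.* g (suc (suc n)) ℤ.+ x) (mul-sucʳ (f ∘ suc) g n))
    (eq (f 0 ℤ.* g (suc (suc n))) (g 0 ℤ.* f (suc (suc n))) _)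
    where
    eq : ∀ a b c → a ℤ.+ (b ℤ.+ c) ≡ b ℤ.+ (a ℤ.+ c)
    eq = solve-∀

  mul-comm : ∀ f g n → mul f g n ≡ mul g f n
  mul-comm f g zero    = ℤ.*-comm (f 0) (g 0)
  mul-comm f g (suc n) = ≡.trans (≡.cong (λ x → f 0 ℤ.* g (suc n) ℤ.+ x) (mul-comm (f ∘ suc) g n))
      (≡.sym (mul-sucʳ g f n))

  mul-distribʳ : ∀ h f g n → mul (λ k → f k ℤ.+ g k) h n ≡ mul f h n ℤ.+ mul g h n
  mul-distribʳ h f g zero    = ℤ.*-distribʳ-+ (h 0) (f 0) (g 0)
  mul-distribʳ h f g (suc n) = ≡.trans (≡.cong (λ x → (f 0 ℤ.+ g 0) ℤ.* h (suc n) ℤ.+ x)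
      (mul-distribʳ h (f ∘ suc) (g ∘ suc) n))
    (eq (f 0) (g 0) (h (suc n)) _ _)
    where
    eq : ∀ a b c x y → (a ℤ.+ b) ℤ.* c ℤ.+ (x ℤ.+ y) ≡ (a ℤ.* c ℤ.+ x) ℤ.+ (b ℤ.* c ℤ.+ y)
    eq = solve-∀

  mul-scale : ∀ c f g n → mul (λ k → c ℤ.* f k) g n ≡ c ℤ.* mul f g n
  mul-scale c f g zero    = ℤ.*-assoc c (f 0) (g 0)
  mul-scale c f g (suc n) = ≡.trans (≡.cong (λ x → c ℤ.* f 0 ℤ.* g (suc n) ℤ.+ x)
      (mul-scale c (f ∘ suc) g n)) (eq c (f 0) (g (suc n)) _)
    where
    eq : ∀ c a b x → c ℤ.* a ℤ.* b ℤ.+ c ℤ.* x ≡ c ℤ.* (a ℤ.* b ℤ.+ x)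
    eq = solve-∀

  mul-assoc : ∀ f g h n → mul (mul f g) h n ≡ mul f (mul g h) n
  mul-assoc f g h zero    = ℤ.*-assoc (f 0) (g 0) (h 0)
  mul-assoc f g h (suc n) = begin
    f 0 ℤ.* g 0 ℤ.* h (suc n) ℤ.+ mul (λ k → f 0 ℤ.* g (suc k) ℤ.+ mul (f ∘ suc) g k) h n
      ≡⟨ ≡.cong (λ x → f 0 ℤ.* g 0 ℤ.* h (suc n) ℤ.+ x)
          (mul-distribʳ h (λ k → f 0 ℤ.* g (suc k)) (mul (f ∘ suc) g) n) ⟩
    f 0 ℤ.* g 0 ℤ.* h (suc n) ℤ.+ (mul (λ k → f 0 ℤ.* g (suc k)) h n ℤ.+ mul (mul (f ∘ suc) g) h n)
      ≡⟨ ≡.cong₂ (λ x y → f 0 ℤ.* g 0 ℤ.* h (suc n) ℤ.+ (x ℤ.+ y)) (mul-scale (f 0) (g ∘ suc) h n)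
          (mul-assoc (f ∘ suc) g h n) ⟩
    f 0 ℤ.* g 0 ℤ.* h (suc n) ℤ.+ (f 0 ℤ.* mul (g ∘ suc) h n ℤ.+ mul (f ∘ suc) (mul g h) n)
      ≡⟨ eq (f 0) (g 0) (h (suc n)) _ _ ⟩
    f 0 ℤ.* (g 0 ℤ.* h (suc n) ℤ.+ mul (g ∘ suc) h n) ℤ.+ mul (f ∘ suc) (mul g h) n ∎
    where
    open ≡.≡-Reasoning
    eq : ∀ a b c x y → a ℤ.* b ℤ.* c ℤ.+ (a ℤ.* x ℤ.+ y) ≡ a ℤ.* (b ℤ.* c ℤ.+ x) ℤ.+ y
    eq = solve-∀

  mul-zeroˡ : ∀ g n → mul (λ _ → 0ℤ) g n ≡ 0ℤ
  mul-zeroˡ g zero    = refl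
  mul-zeroˡ g (suc n) = ≡.trans (ℤ.+-identityˡ _) (mul-zeroˡ g n)

  mul-identityˡ : ∀ g n → mul one g n ≡ g n
  mul-identityˡ g zero    = ℤ.*-identityˡ (g 0)
  mul-identityˡ g (suc n) = ≡.trans (≡.cong₂ ℤ._+_ (ℤ.*-identityˡ (g (suc n))) (mul-zeroˡ g n))
      (ℤ.+-identityʳ _)

  ring : CommutativeRing 0ℓ 0ℓ
  ring = record
    { Carrier = Series
    ; _≈_ = _≈_
    ; _+_ = λ f g n → f n ℤ.+ g n
    ; _*_ = mul
    ; -_  = λ f n → ℤ.- f n
    ; 0#  = λ _ → 0ℤ
    ; 1#  = one
    ; isCommutativeRing = record
      { isRing = record
        { +-isAbelianGroup = record
          { isGroup = record
            { isMonoid = record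
              { isSemigroup = record
                { isMagma = record
                  { isEquivalence = record
                    { refl  = λ _ _ → refl
                    ; sym   = λ f≈g n n≤N → ≡.sym (f≈g n n≤N)
                    ; trans = λ f≈g g≈h n n≤N → ≡.trans (f≈g n n≤N) (g≈h n n≤N)
                    }
                  ; ∙-cong = λ f≈ g≈ n n≤N → ≡.cong₂ ℤ._+_ (f≈ n n≤N) (g≈ n n≤N)
                  }
                ; assoc = λ f g h n _ → ℤ.+-assoc (f n) (g n) (h n)
                }
              ; identity = (λ f n _ → ℤ.+-identityˡ (f n)) , (λ f n _ → ℤ.+-identityʳ (f n))
              }
            ; inverse = (λ f n _ → ℤ.+-inverseˡ (f n)) , (λ f n _ → ℤ.+-inverseʳ (f n))
            ; ⁻¹-cong = λ f≈g n n≤N → ≡.cong ℤ.-_ (f≈g n n≤N)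
            }
          ; comm = λ f g n _ → ℤ.+-comm (f n) (g n)
          }
        ; *-cong = λ f≈ g≈ n n≤N → mul-cong n (λ k k≤n → f≈ k (ℕ.≤-trans k≤n n≤N))
            (λ k k≤n → g≈ k (ℕ.≤-trans k≤n n≤N))
        ; *-assoc = λ f g h n _ → mul-assoc f g h n
        ; *-identity = (λ f n _ → mul-identityˡ f n) ,
            (λ f n _ → ≡.trans (mul-comm f one n) (mul-identityˡ f n))
        ; distrib = (λ h f g n _ → ≡.trans (mul-comm h (λ k → f k ℤ.+ g k) n)
            (≡.trans (mul-distribʳ h f g n)
                        (≡.cong₂ ℤ._+_ (mul-comm f h n) (mul-comm g h n))))
                  , (λ h f g n _ → mul-distribʳ h f g n)
        }
      ; *-comm = λ f g n _ → mul-comm f g n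
      }
    }

  open import Algebra.Properties.Semiring.Exp (CommutativeRing.semiring ring) using (_^_)
  open QSeries ring using (Nilpotent)
  open GeneratingFunctions ring using (gf)

  q : Series
  q zero    = 0ℤ
  q (suc n) = one n

  q* : ∀ f n → mul q f (suc n) ≡ f n
  q* f n = ≡.trans (ℤ.+-identityˡ _) (mul-identityˡ f n)

  q^-diagonal : ∀ k → (q ^ k) k ≡ 1ℤ
  q^-diagonal zero    = refl
  q^-diagonal (suc k) = ≡.trans (q* (q ^ k) k) (q^-diagonal k)

  q^-off : ∀ k n → ¬ k ≡ n → (q ^ k) n ≡ 0ℤ
  q^-off zero    zero    k≢n = contradiction refl k≢n
  q^-off zero    (suc n) k≢n = refl
  q^-off (suc k) zero    k≢n = refl
  q^-off (suc k) (suc n) k≢n = ≡.trans (q* (q ^ k) n) (q^-off k n (k≢n ∘ ≡.cong suc))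

  q-nilpotent : Nilpotent q (suc N)
  q-nilpotent k N<k n n≤N = q^-off k n λ { refl → ℕ.<⇒≱ N<k n≤N }

  coefficient : {X : Set} (w : X → ℕ) (n : ℕ) (xs : List X) → gf q w xs n ≡ + count w n xs
  coefficient w n []       = refl
  coefficient w n (x ∷ xs) with toSum (w x ℕ.≟ n)
  ... | inj₁ refl = ≡.trans (≡.cong₂ ℤ._+_ (q^-diagonal (w x)) (coefficient w n xs))
                      (≡.cong (+_ ∘ length) (≡.sym (filter-accept (λ y → w y ℕ.≟ n) refl)))
  ... | inj₂ w≢n  = ≡.trans (≡.cong₂ ℤ._+_ (q^-off (w x) n w≢n) (coefficient w n xs))
                      (≡.trans (ℤ.+-identityˡ _) (≡.cong (+_ ∘ length)
                          (≡.sym (filter-reject (λ y → w y ℕ.≟ n) w≢n))))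

  gf≈⇒count≡ : {X Y : Set} {w : X → ℕ} {v : Y → ℕ} (xs : List X) (ys : List Y) →
               gf q w xs ≈ gf q v ys → count w N xs ≡ count v N ys
  gf≈⇒count≡ xs ys eq = ℤ.+-injective
    (≡.trans (≡.sym (coefficient _ N xs)) (≡.trans (eq N ℕ.≤-refl) (coefficient _ N ys)))

theorem8 : (n : ℕ) → .{{_ : NonZero n}} → (A n ≡ B n) × (B n ≡ C n)
theorem8 n = ≡.trans A≡ (≡.trans (gf≈⇒count≡ (partitions p (suc M)) (configurations false p 2 0 false)
                            (λ k k≤n → ≡.trans (a≈W q q-nilpotent ℕ.z<s k k≤n) (≡.sym (gfB≈W k k≤n))))
                                (≡.sym B≡))
           , ≡.trans B≡ (≡.trans (gf≈⇒count≡ (configurations false p 2 0 false)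
               (configurations true p 2 0 false)
                            (λ k k≤n → ≡.trans (gfB≈W k k≤n) (≡.sym (gfC≈V q p 2 0 k k≤n)))) (≡.sym C≡))
  where
  open TruncatedPowerSeries n
  open GeneratingFunctions ring
  open ConfigurationSeries ring
  -- M is the nilpotency exponent n + 1. The same p = 7M is the largest part for A, where a block of
  -- seven ends, and the fuel for B and C, as in the `W` of `a≈W`.
  M p : ℕ
  M = suc n
  p = M ℕ.* 7
  n≤p : n ≤ p
  n≤p = ℕ.≤-trans (ℕ.n≤1+n n) (ℕ.m≤m*n M 7)
  n<p+2 : n < p ℕ.+ 2
  n<p+2 = ℕ.≤-trans (s≤s n≤p) (ℕ.≤-trans (ℕ.n≤1+n (suc p)) (ℕ.≤-reflexive (ℕ.+-comm 2 p)))
  gfB≈W = gfB≈V q (nil-*7 q q-nilpotent) p 2 false (ℕ.≤-trans (ℕ.n≤1+n (suc p))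
      (ℕ.≤-reflexive (ℕ.+-comm 2 p)))
  A≡ = A≡count n p (suc M) n≤p (ℕ.≤-trans (ℕ.n≤1+n n) (ℕ.n≤1+n M))
  B≡ = D≡count false n p (enumerationB n) (InB⇔InD n) n<p+2
  C≡ = D≡count true n p (enumerationC n) (InC⇔InD n) n<p+2
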